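{- For any graph $G$ with chromatic number $\chi(G)\ge 3$, we have $s(n,G)=(1+o(1))\mathrm{ex}(n,G)$ as $n\to\infty$. If $G$ is bipartite, then $s(n,G)=o(n^2)$.
   Context: For a graph $H$, $F_{H,0}$ is the set of maps $f:E(H)\to E(H)$ with $f(e)\cap e=\emptyset$ for every $e\in E(H)$. Given such an $f$, a subgraph $G'$ of $H$ is $f$-exclusive if $f(e)\cap V(G')=\emptyset$ for every $e\in E(G')$. For $n\ge 4$, $s(n,G)$ is the maximum number of edges of an $n$-vertex graph $H$ for which some $f\in F_{H,0}$ exists with no $f$-exclusive copy of $G$ in $H$. $\mathrm{ex}(n,G)$ is the Turán number. -}

module Defs where

open import Data.Nat using (ℕ; suc; _<_; _≤_; _<ᵇ_; _*_; _^_)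
open import Data.Fin using (Fin; toℕ)
open import Data.Bool using (Bool; true; false; _∧_; if_then_else_)
open import Data.List using (List; map; allFin)
open import Data.Nat.ListAction using (sum)
open import Data.Product using (Σ; _×_; _,_; proj₁; proj₂; ∃)
open import Data.Sum using (_⊎_)
open import Relation.Binary.PropositionalEquality using (_≡_; _≢_)
open import Relation.Nullary using (¬_)
open import Function.Definitions using (Injective)

record Graph (n : ℕ) : Set where
  field
    adj    : Fin n → Fin n → Bool
    sym    : ∀ i j → adj i j ≡ adj j i
    irrefl : ∀ i → adj i i ≡ false

open Graph public

-- Edges, each unordered edge {i,j} represented once, as (i , j) with i < j.
Edge : ∀ {n} → Graph n → Set
Edge {n} H = Σ (Fin n × Fin n) λ p →
  (toℕ (proj₁ p) < toℕ (proj₂ p)) × (adj H (proj₁ p) (proj₂ p) ≡ true)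

src tgt : ∀ {n} (H : Graph n) → Edge H → Fin n
src H e = proj₁ (proj₁ e)
tgt H e = proj₂ (proj₁ e)

Ends : ∀ {n} (H : Graph n) → Edge H → Fin n → Set
Ends H e x = (x ≡ src H e) ⊎ (x ≡ tgt H e)

SameEnds : ∀ {n} (H : Graph n) → Edge H → Fin n → Fin n → Set
SameEnds H e u w = (src H e ≡ u × tgt H e ≡ w) ⊎ (src H e ≡ w × tgt H e ≡ u)

edgeCount : ∀ {n} → Graph n → ℕ
edgeCount {n} H = sum (map (λ i → sum (map (λ j →
  if (toℕ i <ᵇ toℕ j) ∧ adj H i j then 1 else 0) (allFin n))) (allFin n))

F0 : ∀ {n} → Graph n → Set
F0 H = Σ (Edge H → Edge H) λ f →
  ∀ e x → Ends H (f e) x → ¬ Ends H e x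

-- A copy of G in H: an injective edge-preserving vertex map; the copy G'
-- has V(G') = image of φ and E(G') = images of the edges of G.
record Copy {v n} (G : Graph v) (H : Graph n) : Set where
  field
    φ     : Fin v → Fin n
    inj   : Injective _≡_ _≡_ φ
    pres  : ∀ a b → adj G a b ≡ true → adj H (φ a) (φ b) ≡ true

open Copy public

Exclusive : ∀ {v n} {G : Graph v} {H : Graph n} → F0 H → Copy G H → Set
Exclusive {G = G} {H = H} f c =
  ∀ (eG : Edge G) (eH : Edge H) → SameEnds H eH (φ c (src G eG)) (φ c (tgt G eG)) →
  ∀ x → ¬ Ends H (proj₁ f eH) (φ c x)

IsMax : (ℕ → Set) → ℕ → Set
IsMax P m = P m × (∀ m′ → P m′ → m′ ≤ m)

SWitness : ∀ {v} → ℕ → Graph v → ℕ → Set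
SWitness n G m = Σ (Graph n) λ H → (edgeCount H ≡ m) ×
  Σ (F0 H) λ f → ∀ (c : Copy G H) → ¬ Exclusive f c

ExWitness : ∀ {v} → ℕ → Graph v → ℕ → Set
ExWitness n G m = Σ (Graph n) λ H → (edgeCount H ≡ m) × ¬ Copy G H

IsS : ∀ {v} → ℕ → Graph v → ℕ → Set
IsS n G = IsMax (SWitness n G)

IsEx : ∀ {v} → ℕ → Graph v → ℕ → Set
IsEx n G = IsMax (ExWitness n G)

Colorable : ∀ {v} → ℕ → Graph v → Set
Colorable {v} k G = Σ (Fin v → Fin k) λ c →
  ∀ a b → adj G a b ≡ true → c a ≢ c b

ChromaticAtLeast3 : ∀ {v} → Graph v → Set
ChromaticAtLeast3 G = ¬ Colorable 2 G

Bipartite : ∀ {v} → Graph v → Set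
Bipartite G = Colorable 2 G

{-# OPTIONS --safe #-}

-- Let χ(G) = r + 1.  By the Erdős–Stone argument (prune to large minimum degree, then grow a complete
-- multipartite graph part by part), for some m every m-vertex graph of density above 1 - 1/r + ε
-- contains G.  If H has n vertices and density above 1 - 1/r + ε, consider a random map
-- ι : Fin m → Fin n.  The expected density of the induced graph is that of H, whereas a collision or an
-- edge ι i, ι j with ι l ∈ f(ι i ι j) occurs with probability O(1/n), since every edge e excludes only
-- the two vertices of f(e).  So for large n some ι gives a dense induced graph with no such event, and
-- every copy of G in it is f-exclusive.  Conversely an extremal G-free graph has so many edges that
-- every edge has a disjoint one, hence F_{H,0} is nonempty and s(n,G) ≥ ex(n,G); and ex(n,G) is at
-- least the Turán density because some r-partite graph does as well as the average one.

module Submission where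

open import Defs
open import Axiom.UniquenessOfIdentityProofs using (module Decidable⇒UIP)
open import Data.Bool using (Bool; true; false; not; _∧_; if_then_else_)
import Data.Bool.Properties as Bool
open import Data.Fin as Fin using (Fin; zero; suc; toℕ)
import Data.Fin.Properties as Fin
open import Data.List using (List; []; _∷_; map; length; allFin; filter; take; concat; lookup)
open import Data.List.Membership.Propositional using (_∈_; find)
open import Data.List.Membership.Propositional.Properties using (∈-allFin; ∈-lookup)
open import Data.List.Properties using (length-++; length-map; length-removeAt′; length-tabulate; length-take; map-tabulate)
open import Data.List.Relation.Unary.All as All using (All; []; _∷_)
import Data.List.Relation.Unary.All.Properties as All
open import Data.List.Relation.Unary.AllPairs as AllPairs using (AllPairs; []; _∷_)
import Data.List.Relation.Unary.AllPairs.Properties as AllPairs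
open import Data.List.Relation.Unary.Any as Any using (Any; here; there; _─_)
open import Data.List.Relation.Unary.Unique.Propositional using (Unique)
open import Data.List.Relation.Unary.Unique.Propositional.Properties using (allFin⁺)
open import Data.Nat hiding (equal)
open import Data.Nat.ListAction using (sum)
open import Data.Nat.Properties
open import Data.Nat.Tactic.RingSolver using (solve-∀)
open import Data.Product as Product using (Σ; ∃; _×_; _,_; proj₁; proj₂)
open import Data.Sum using (_⊎_; inj₁; inj₂)
import Data.Vec.Functional as Vector
open import Function using (_∘_; id)
open import Relation.Binary.Definitions using (tri<; tri≈; tri>)
open import Relation.Binary.PropositionalEquality as ≡ hiding (sym)
open import Relation.Nullary using (¬_; Dec; yes; no; does; contradiction)
open import Relation.Nullary.Decidable using (dec-true; dec-false; map′; _×-dec_; ¬?; _→-dec_)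

-- Finite sums over lists and indicators.

∑ : {A : Set} → List A → (A → ℕ) → ℕ
∑ xs f = sum (map f xs)

module _ {A : Set} where

  ∑-cong : ∀ {f g : A → ℕ} xs → (∀ x → f x ≡ g x) → ∑ xs f ≡ ∑ xs g
  ∑-cong []       f≡g = refl
  ∑-cong (x ∷ xs) f≡g = cong₂ _+_ (f≡g x) (∑-cong xs f≡g)

  ∑-mono-All : ∀ {f g : A → ℕ} {xs} → All (λ x → f x ≤ g x) xs → ∑ xs f ≤ ∑ xs g
  ∑-mono-All []          = z≤n
  ∑-mono-All (f≤g ∷ all) = +-mono-≤ f≤g (∑-mono-All all)

  ∑-mono : ∀ {f g : A → ℕ} xs → (∀ x → f x ≤ g x) → ∑ xs f ≤ ∑ xs g
  ∑-mono xs f≤g = ∑-mono-All (All.universal f≤g xs)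

  ∑-distrib-+ : ∀ (f g : A → ℕ) xs → ∑ xs (λ x → f x + g x) ≡ ∑ xs f + ∑ xs g
  ∑-distrib-+ f g []       = refl
  ∑-distrib-+ f g (x ∷ xs) = trans (cong (f x + g x +_) (∑-distrib-+ f g xs))
                                   (interchange (f x) (g x) (∑ xs f) (∑ xs g))
    where
    interchange : ∀ a b c d → a + b + (c + d) ≡ a + c + (b + d)
    interchange = solve-∀

  ∑-distrib-* : ∀ c (f : A → ℕ) xs → ∑ xs (λ x → c * f x) ≡ c * ∑ xs f
  ∑-distrib-* c f []       = ≡.sym (*-zeroʳ c)
  ∑-distrib-* c f (x ∷ xs) = trans (cong (c * f x +_) (∑-distrib-* c f xs))
                                   (≡.sym (*-distribˡ-+ c (f x) (∑ xs f)))

  ∑-const : ∀ (xs : List A) c → ∑ xs (λ _ → c) ≡ length xs * c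
  ∑-const []       c = refl
  ∑-const (x ∷ xs) c = cong (c +_) (∑-const xs c)

  member≤∑ : ∀ (f : A → ℕ) {x xs} → x ∈ xs → f x ≤ ∑ xs f
  member≤∑ f (here refl)              = m≤m+n _ _
  member≤∑ f (there {x = y} x∈xs)     = ≤-trans (member≤∑ f x∈xs) (m≤n+m _ (f y))

  ∑-proportional : ∀ {f g : A → ℕ} c d xs → (∀ x → c * f x ≡ d * g x) →
                   c * ∑ xs f ≡ d * ∑ xs g
  ∑-proportional {f} {g} c d xs cf≡dg = trans (≡.sym (∑-distrib-* c f xs))
    (trans (∑-cong xs cf≡dg) (∑-distrib-* d g xs))

  ∑-<⇒∃< : ∀ (f g : A → ℕ) xs → ∑ xs f < ∑ xs g → ∃ λ x → f x < g x
  ∑-<⇒∃< f g (x ∷ xs) Σf<Σg with f x <? g x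
  ... | yes fx<gx = x , fx<gx
  ... | no  fx≮gx = ∑-<⇒∃< f g xs
    (≰⇒> λ Σg≤Σf → <⇒≱ Σf<Σg (+-mono-≤ (≮⇒≥ fx≮gx) Σg≤Σf))

∑-swap : ∀ {A B : Set} (f : A → B → ℕ) xs ys →
         ∑ xs (λ x → ∑ ys (f x)) ≡ ∑ ys (λ y → ∑ xs (λ x → f x y))
∑-swap f []       ys = ≡.sym (trans (∑-const ys 0) (*-zeroʳ (length ys)))
∑-swap f (x ∷ xs) ys = trans (cong (∑ ys (f x) +_) (∑-swap f xs ys))
  (≡.sym (∑-distrib-+ (f x) (λ y → ∑ xs (λ x → f x y)) ys))

𝟙 : Bool → ℕ
𝟙 true  = 1
𝟙 false = 0

𝟙≤1 : ∀ b → 𝟙 b ≤ 1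
𝟙≤1 true  = ≤-refl
𝟙≤1 false = z≤n

𝟙-+-not : ∀ b → 𝟙 b + 𝟙 (not b) ≡ 1
𝟙-+-not true  = refl
𝟙-+-not false = refl

-- Sums over Fin n

length-allFin : ∀ n → length (allFin n) ≡ n
length-allFin n = length-tabulate {n = n} id

∑-allFin-const : ∀ n c → ∑ (allFin n) (λ _ → c) ≡ n * c
∑-allFin-const n c = trans (∑-const (allFin n) c) (cong (_* c) (length-allFin n))

∑-allFin-≤-const : ∀ {n} {f : Fin n → ℕ} c → (∀ i → f i ≤ c) → ∑ (allFin n) f ≤ n * c
∑-allFin-≤-const {n} c f≤c = ≤-trans (∑-mono (allFin n) f≤c) (≤-reflexive (∑-allFin-const n c))

term≤∑ : ∀ {n} (f : Fin n → ℕ) i → f i ≤ ∑ (allFin n) f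
term≤∑ f i = member≤∑ f (∈-allFin i)

∑-allFin-suc : ∀ {n} (f : Fin (suc n) → ℕ) →
               ∑ (allFin (suc n)) f ≡ f zero + ∑ (allFin n) (f ∘ suc)
∑-allFin-suc f = cong (λ fs → f zero + sum fs)
  (trans (map-tabulate suc f) (≡.sym (map-tabulate id (f ∘ suc))))

equal distinct : ∀ {n} → Fin n → Fin n → ℕ
equal    i j = 𝟙 (does (i Fin.≟ j))
distinct i j = 𝟙 (not (does (i Fin.≟ j)))

equal-refl : ∀ {n} (i : Fin n) → equal i i ≡ 1
equal-refl i = cong 𝟙 (dec-true (i Fin.≟ i) refl)

distinct-≢ : ∀ {n} {i j : Fin n} → i ≢ j → distinct i j ≡ 1
distinct-≢ {i = i} {j} i≢j = cong (𝟙 ∘ not) (dec-false (i Fin.≟ j) i≢j)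

equal-suc : ∀ {n} (i j : Fin n) → equal (suc i) (suc j) ≡ equal i j
equal-suc i j with i Fin.≟ j
... | yes _ = refl
... | no  _ = refl

∑-equal : ∀ {n} (i : Fin n) → ∑ (allFin n) (equal i) ≡ 1
∑-equal {suc n} zero = trans (∑-allFin-suc {n} (equal zero))
  (cong suc (trans (∑-const (allFin n) 0) (*-zeroʳ (length (allFin n)))))
∑-equal {suc n} (suc i) = trans (∑-allFin-suc (equal (suc i)))
  (trans (∑-cong (allFin n) (equal-suc i)) (∑-equal i))

∑-distinct : ∀ {n} (i : Fin n) → ∑ (allFin n) (distinct i) ≡ pred n
∑-distinct {n} i = cong pred (begin
  1 + ∑ (allFin n) (distinct i)
    ≡⟨ cong₂ _+_ (∑-equal i) refl ⟨
  ∑ (allFin n) (equal i) + ∑ (allFin n) (distinct i)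
    ≡⟨ ∑-distrib-+ (equal i) (distinct i) (allFin n) ⟨
  ∑ (allFin n) (λ j → equal i j + distinct i j)
    ≡⟨ ∑-cong (allFin n) (λ j → 𝟙-+-not (does (i Fin.≟ j))) ⟩
  ∑ (allFin n) (λ _ → 1)
    ≡⟨ ∑-allFin-const n 1 ⟩
  n * 1
    ≡⟨ *-identityʳ n ⟩
  n ∎)
  where open ≡-Reasoning

∑-∑-distinct : ∀ n → ∑ (allFin n) (λ i → ∑ (allFin n) (distinct i)) ≡ n * pred n
∑-∑-distinct n = trans (∑-cong (allFin n) ∑-distinct) (∑-allFin-const n (pred n))

-- Sums over all functions Fin m → A

module Sampling {A : Set} (xs : List A) {n : ℕ} (∣xs∣≡n : length xs ≡ n) where

  private
    ∑-xs-const : ∀ c → ∑ xs (λ _ → c) ≡ n * c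
    ∑-xs-const c = trans (∑-const xs c) (cong (_* c) ∣xs∣≡n)

  -- This is `n ^ m` times the expectation of `F` when the values of the function are chosen
  -- independently and uniformly from `xs`. All averages below are kept in this form, with
  -- denominators cleared.
  ∑ᶠ : ∀ m → ((Fin m → A) → ℕ) → ℕ
  ∑ᶠ zero    F = F λ ()
  ∑ᶠ (suc m) F = ∑ xs λ x → ∑ᶠ m λ φ → F (x Vector.∷ φ)

  ∑ᶠ-cong : ∀ m {F G : (Fin m → A) → ℕ} → (∀ φ → F φ ≡ G φ) → ∑ᶠ m F ≡ ∑ᶠ m G
  ∑ᶠ-cong zero    F≡G = F≡G _
  ∑ᶠ-cong (suc m) F≡G = ∑-cong xs λ x → ∑ᶠ-cong m λ φ → F≡G _

  ∑ᶠ-distrib-+ : ∀ m (F G : (Fin m → A) → ℕ) → ∑ᶠ m (λ φ → F φ + G φ) ≡ ∑ᶠ m F + ∑ᶠ m G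
  ∑ᶠ-distrib-+ zero    F G = refl
  ∑ᶠ-distrib-+ (suc m) F G = trans
    (∑-cong xs λ x → ∑ᶠ-distrib-+ m (λ φ → F (x Vector.∷ φ)) (λ φ → G (x Vector.∷ φ)))
    (∑-distrib-+ _ _ xs)

  ∑ᶠ-distrib-* : ∀ m c (F : (Fin m → A) → ℕ) → ∑ᶠ m (λ φ → c * F φ) ≡ c * ∑ᶠ m F
  ∑ᶠ-distrib-* zero    c F = refl
  ∑ᶠ-distrib-* (suc m) c F = trans
    (∑-cong xs λ x → ∑ᶠ-distrib-* m c (λ φ → F (x Vector.∷ φ)))
    (∑-distrib-* c _ xs)

  ∑ᶠ-const : ∀ m c → ∑ᶠ m (λ _ → c) ≡ n ^ m * c
  ∑ᶠ-const zero    c = ≡.sym (+-identityʳ c)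
  ∑ᶠ-const (suc m) c = trans (∑-cong xs λ _ → ∑ᶠ-const m c)
    (trans (∑-xs-const (n ^ m * c)) (≡.sym (*-assoc n (n ^ m) c)))

  ∑ᶠ-∑-swap : ∀ m {B : Set} (F : B → (Fin m → A) → ℕ) ys →
              ∑ᶠ m (λ φ → ∑ ys (λ y → F y φ)) ≡ ∑ ys (λ y → ∑ᶠ m (F y))
  ∑ᶠ-∑-swap zero    F ys = refl
  ∑ᶠ-∑-swap (suc m) F ys = trans
    (∑-cong xs λ x → ∑ᶠ-∑-swap m (λ y φ → F y (x Vector.∷ φ)) ys)
    (∑-swap _ xs ys)

  -- The first-moment method: a smaller average forces a smaller value somewhere. The witness is
  -- built one coordinate at a time.
  ∑ᶠ-<⇒∃< : ∀ m (F G : (Fin m → A) → ℕ) → ∑ᶠ m F < ∑ᶠ m G → ∃ λ φ → F φ < G φ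
  ∑ᶠ-<⇒∃< zero    F G F<G = _ , F<G
  ∑ᶠ-<⇒∃< (suc m) F G F<G =
    let x , Fx<Gx = ∑-<⇒∃< _ _ xs F<G
        φ , Fφ<Gφ = ∑ᶠ-<⇒∃< m _ _ Fx<Gx
    in  x Vector.∷ φ , Fφ<Gφ

  private
    -- Summing over a coordinate that is not read multiplies the sum by `n`, which the change from
    -- `n ^ m` to `n ^ suc m` absorbs.
    skip-coordinate : ∀ m c (F : (Fin m → A) → ℕ) {s} → c * ∑ᶠ m F ≡ n ^ m * s →
                      c * ∑ xs (λ _ → ∑ᶠ m F) ≡ n ^ suc m * s
    skip-coordinate m c F {s} eq = begin
      c * ∑ xs (λ _ → ∑ᶠ m F) ≡⟨ cong (c *_) (∑-xs-const (∑ᶠ m F)) ⟩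
      c * (n * ∑ᶠ m F)        ≡⟨ left-comm c n (∑ᶠ m F) ⟩
      n * (c * ∑ᶠ m F)        ≡⟨ cong (n *_) eq ⟩
      n * (n ^ m * s)         ≡⟨ *-assoc n (n ^ m) s ⟨
      n * n ^ m * s           ∎
      where
      open ≡-Reasoning
      left-comm : ∀ a b c → a * (b * c) ≡ b * (a * c)
      left-comm = solve-∀

    use-coordinate : ∀ m c {f g : A → ℕ} {s} → (∀ x → c * f x ≡ n ^ m * g x) → ∑ xs g ≡ s →
                     n * c * ∑ xs f ≡ n ^ suc m * s
    use-coordinate m c {f} {g} {s} eq refl = begin
      n * c * ∑ xs f       ≡⟨ *-assoc n c (∑ xs f) ⟩
      n * (c * ∑ xs f)     ≡⟨ cong (n *_) (∑-proportional c (n ^ m) xs eq) ⟩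
      n * (n ^ m * ∑ xs g) ≡⟨ *-assoc n (n ^ m) (∑ xs g) ⟨
      n * n ^ m * ∑ xs g   ∎
      where open ≡-Reasoning

  marginal₁ : ∀ {m} (g : A → ℕ) (i : Fin m) →
              n * 1 * ∑ᶠ m (λ φ → g (φ i)) ≡ n ^ m * ∑ xs g
  marginal₁ {suc m} g zero = use-coordinate m 1
    (λ x → trans (*-identityˡ _) (∑ᶠ-const m (g x))) refl
  marginal₁ {suc m} g (suc i) = skip-coordinate m (n * 1) _ (marginal₁ g i)

  -- Distinct coordinates are independent, so the pair is uniform: the expectation of `g` is its sum
  -- over all pairs divided by `n` squared. The form `n * (n * 1)` is the one that repeated use of
  -- `use-coordinate` produces.
  marginal₂ : ∀ {m} (g : A → A → ℕ) (i j : Fin m) → i ≢ j →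
              n * (n * 1) * ∑ᶠ m (λ φ → g (φ i) (φ j)) ≡ n ^ m * ∑ xs (λ x → ∑ xs (g x))
  marginal₂ g zero zero i≢j = contradiction refl i≢j
  marginal₂ {suc m} g zero (suc j) _ = use-coordinate m (n * 1)
    (λ x → marginal₁ (g x) j) refl
  marginal₂ {suc m} g (suc i) zero _ = use-coordinate m (n * 1)
    (λ y → marginal₁ (λ x → g x y) i) (∑-swap (λ y x → g x y) xs xs)
  marginal₂ {suc m} g (suc i) (suc j) i≢j = skip-coordinate m (n * (n * 1)) _
    (marginal₂ g i j (i≢j ∘ cong suc))

  marginal₃ : ∀ {m} (g : A → A → A → ℕ) (i j l : Fin m) → i ≢ j → i ≢ l → j ≢ l →
              n * (n * (n * 1)) * ∑ᶠ m (λ φ → g (φ i) (φ j) (φ l)) ≡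
              n ^ m * ∑ xs (λ x → ∑ xs (λ y → ∑ xs (g x y)))
  marginal₃ g zero zero l i≢j _ _ = contradiction refl i≢j
  marginal₃ g zero (suc j) zero _ i≢l _ = contradiction refl i≢l
  marginal₃ g (suc i) zero zero _ _ j≢l = contradiction refl j≢l
  marginal₃ {suc m} g zero (suc j) (suc l) _ _ j≢l = use-coordinate m (n * (n * 1))
    (λ x → marginal₂ (g x) j l (j≢l ∘ cong suc)) refl
  marginal₃ {suc m} g (suc i) zero (suc l) _ i≢l _ = use-coordinate m (n * (n * 1))
    (λ y → marginal₂ (λ x z → g x y z) i l (i≢l ∘ cong suc))
    (∑-swap (λ y x → ∑ xs (g x y)) xs xs)
  marginal₃ {suc m} g (suc i) (suc j) zero i≢j _ _ = use-coordinate m (n * (n * 1))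
    (λ z → marginal₂ (λ x y → g x y z) i j (i≢j ∘ cong suc))
    (trans (∑-swap (λ z x → ∑ xs (λ y → g x y z)) xs xs)
           (∑-cong xs λ x → ∑-swap (λ z y → g x y z) xs xs))
  marginal₃ {suc m} g (suc i) (suc j) (suc l) i≢j i≢l j≢l = skip-coordinate m (n * (n * (n * 1))) _
    (marginal₃ g i j l (i≢j ∘ cong suc) (i≢l ∘ cong suc) (j≢l ∘ cong suc))

-- Degree sums of random induced graphs

degreeSum : ∀ {n} → Graph n → ℕ
degreeSum {n} H = ∑ (allFin n) λ i → ∑ (allFin n) λ j → 𝟙 (adj H i j)

degreeSum≡2*edgeCount : ∀ {n} (H : Graph n) → degreeSum H ≡ 2 * edgeCount H
degreeSum≡2*edgeCount {n} H = begin
  degreeSum H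
    ≡⟨ ∑-cong (allFin n) (λ i → ∑-cong (allFin n) (orient i)) ⟩
  ∑ (allFin n) (λ i → ∑ (allFin n) (λ j → up i j + up j i))
    ≡⟨ ∑-cong (allFin n) (λ i → ∑-distrib-+ (up i) (λ j → up j i) (allFin n)) ⟩
  ∑ (allFin n) (λ i → ∑ (allFin n) (up i) + ∑ (allFin n) (λ j → up j i))
    ≡⟨ ∑-distrib-+ (λ i → ∑ (allFin n) (up i)) _ (allFin n) ⟩
  edgeCount H + ∑ (allFin n) (λ i → ∑ (allFin n) (λ j → up j i))
    ≡⟨ cong (edgeCount H +_) (∑-swap (λ i j → up j i) (allFin n) (allFin n)) ⟩
  edgeCount H + edgeCount H
    ≡⟨ cong (edgeCount H +_) (+-identityʳ _) ⟨
  2 * edgeCount H ∎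
  where
  open ≡-Reasoning
  up : Fin n → Fin n → ℕ
  up i j = if (toℕ i <ᵇ toℕ j) ∧ adj H i j then 1 else 0

  𝟙-if : ∀ b → 𝟙 b ≡ (if b then 1 else 0)
  𝟙-if true  = refl
  𝟙-if false = refl

  orient : ∀ i j → 𝟙 (adj H i j) ≡ up i j + up j i
  orient i j with <-cmp (toℕ i) (toℕ j)
  ... | tri< i<j _ j≮i
    rewrite dec-true (toℕ i <? toℕ j) i<j | dec-false (toℕ j <? toℕ i) j≮i =
    trans (𝟙-if (adj H i j)) (≡.sym (+-identityʳ _))
  ... | tri> i≮j _ j<i
    rewrite dec-false (toℕ i <? toℕ j) i≮j | dec-true (toℕ j <? toℕ i) j<i | sym H i j =
    𝟙-if (adj H j i)
  ... | tri≈ i≮j i≡j j≮i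
    rewrite dec-false (toℕ i <? toℕ j) i≮j | dec-false (toℕ j <? toℕ i) j≮i
          | Fin.toℕ-injective i≡j | irrefl H j = refl

degreeSum≤n*n : ∀ {n} (H : Graph n) → degreeSum H ≤ n * n
degreeSum≤n*n {n} H = ∑-allFin-≤-const n λ i →
  ≤-trans (∑-allFin-≤-const 1 λ j → 𝟙≤1 (adj H i j)) (≤-reflexive (*-identityʳ n))

-- For injective `φ` this is the induced graph on the image. Other maps give nonadjacent twins, so
-- every sampled map has a graph on `Fin m`.
pullback : ∀ {m n} → Graph n → (Fin m → Fin n) → Graph m
pullback H φ = record
  { adj    = λ i j → adj H (φ i) (φ j)
  ; sym    = λ i j → sym H (φ i) (φ j)
  ; irrefl = λ i → irrefl H (φ i)
  }

private
  -- Here `X`, `Y`, `Z` are the totals of collisions, forbidden triples and degree sums over all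
  -- maps. After multiplication by the cube of `n`, the bad events cost `n ^ m * (n * n)` times the
  -- left side of the first inequality, and the extra `n ^ m * 1` pays one further factor `n`.
  averaging-arithmetic : ∀ n m a b d e X Y Z → .{{NonZero n}} →
    suc (b * (m * m)) * (m * m + m * (m * (m * d))) < n →
    a * (n * n) ≤ b * e →
    n * (n * 1) * X ≡ n ^ m * n * (m * pred m) →
    n * (n * (n * 1)) * Y ≤ m * (m * (m * (n ^ m * (n * (n * d))))) →
    n * (n * 1) * Z ≡ n ^ m * e * (m * pred m) →
    n ^ m * (a * (m * pred m)) + suc (b * (m * m)) * (X + Y) < n ^ m * 1 + b * Z
  averaging-arithmetic n m a b d e X Y Z n-large dense X≡ Y≤ Z≡ =
    *-cancelˡ-< (n * (n * (n * 1))) _ _ (begin-strict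
      n * (n * (n * 1)) * (P * (a * Q) + D * (X + Y))
        ≡⟨ expand-lhs n P Q a D X Y ⟩
      P * Q * n * (a * (n * n)) + D * (n * (n * (n * 1) * X) + n * (n * (n * 1)) * Y)
        ≤⟨ +-mono-≤ (*-monoʳ-≤ (P * Q * n) dense) (*-monoʳ-≤ D (+-mono-≤
             (*-monoʳ-≤ n (≤-trans (≤-reflexive X≡)
                                   (*-monoʳ-≤ (P * n) (*-monoʳ-≤ m (pred[n]≤n {m})))))
             Y≤)) ⟩
      P * Q * n * (b * e) + D * (n * (P * n * (m * m)) + m * (m * (m * (P * (n * (n * d))))))
        ≡⟨ cong (P * Q * n * (b * e) +_) (expand-bad n P D m d) ⟩
      P * Q * n * (b * e) + P * (n * n) * (D * (m * m + m * (m * (m * d))))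
        <⟨ +-monoʳ-< (P * Q * n * (b * e)) (*-monoʳ-< (P * (n * n)) {{Pnn≢0}} n-large) ⟩
      P * Q * n * (b * e) + P * (n * n) * n
        ≡⟨ expand-main n P Q b e ⟩
      n * (b * (P * e * Q)) + n * (n * (n * 1)) * (P * 1)
        ≡⟨ cong (λ s → n * (b * s) + n * (n * (n * 1)) * (P * 1)) Z≡ ⟨
      n * (b * (n * (n * 1) * Z)) + n * (n * (n * 1)) * (P * 1)
        ≡⟨ expand-rhs n P b Z ⟩
      n * (n * (n * 1)) * (P * 1 + b * Z) ∎)
    where
    open ≤-Reasoning
    D = suc (b * (m * m))
    P = n ^ m
    Q = m * pred m
    Pnn≢0 : NonZero (P * (n * n))
    Pnn≢0 = m*n≢0 P (n * n) {{m^n≢0 n m}} {{m*n≢0 n n}}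
    expand-lhs : ∀ n P Q a D X Y → n * (n * (n * 1)) * (P * (a * Q) + D * (X + Y)) ≡
                 P * Q * n * (a * (n * n)) + D * (n * (n * (n * 1) * X) + n * (n * (n * 1)) * Y)
    expand-lhs = solve-∀
    expand-bad : ∀ n P D m d → D * (n * (P * n * (m * m)) + m * (m * (m * (P * (n * (n * d)))))) ≡
                 P * (n * n) * (D * (m * m + m * (m * (m * d))))
    expand-bad = solve-∀
    expand-main : ∀ n P Q b e → P * Q * n * (b * e) + P * (n * n) * n ≡
                  n * (b * (P * e * Q)) + n * (n * (n * 1)) * (P * 1)
    expand-main = solve-∀
    expand-rhs : ∀ n P b Z → n * (b * (n * (n * 1) * Z)) + n * (n * (n * 1)) * (P * 1) ≡
                 n * (n * (n * 1)) * (P * 1 + b * Z)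
    expand-rhs = solve-∀

module _ (n : ℕ) where
  open Sampling (allFin n) (length-allFin n)

  off-diagonal-marginal : ∀ {m} (g : Fin n → Fin n → ℕ) (i j : Fin m) →
    n * (n * 1) * ∑ᶠ m (λ φ → distinct i j * g (φ i) (φ j)) ≡
    n ^ m * ∑ (allFin n) (λ x → ∑ (allFin n) (g x)) * distinct i j
  off-diagonal-marginal {m} g i j with i Fin.≟ j
  ... | yes _ = trans (cong (n * (n * 1) *_) (∑ᶠ-const m 0)) (lemma (n * (n * 1)) (n ^ m) _)
    where
    lemma : ∀ a b c → a * (b * 0) ≡ b * c * 0
    lemma = solve-∀
  ... | no i≢j = trans
    (cong (n * (n * 1) *_) (∑ᶠ-cong m λ φ → +-identityʳ _))
    (trans (marginal₂ g i j i≢j) (≡.sym (*-identityʳ _)))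

  -- There are `m * pred m` ordered pairs of distinct coordinates, each uniform by `marginal₂`. The
  -- factor `distinct i j` lets the sum run over all pairs.
  off-diagonal-sum : ∀ m (g : Fin n → Fin n → ℕ) →
    n * (n * 1) * ∑ᶠ m (λ φ → ∑ (allFin m) λ i → ∑ (allFin m) λ j → distinct i j * g (φ i) (φ j)) ≡
    n ^ m * ∑ (allFin n) (λ x → ∑ (allFin n) (g x)) * (m * pred m)
  off-diagonal-sum m g = begin
    c * ∑ᶠ m (λ φ → ∑ (allFin m) λ i → ∑ (allFin m) λ j → term i j φ)
      ≡⟨ cong (c *_) (∑ᶠ-∑-swap m (λ i φ → ∑ (allFin m) λ j → term i j φ) (allFin m)) ⟩
    c * ∑ (allFin m) (λ i → ∑ᶠ m λ φ → ∑ (allFin m) λ j → term i j φ)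
      ≡⟨ cong (c *_) (∑-cong (allFin m) λ i → ∑ᶠ-∑-swap m (term i) (allFin m)) ⟩
    c * ∑ (allFin m) (λ i → ∑ (allFin m) λ j → ∑ᶠ m (term i j))
      ≡⟨ ∑-proportional c d (allFin m) (λ i →
           ∑-proportional c d (allFin m) (off-diagonal-marginal g i)) ⟩
    d * ∑ (allFin m) (λ i → ∑ (allFin m) (distinct i))
      ≡⟨ cong (d *_) (∑-∑-distinct m) ⟩
    d * (m * pred m) ∎
    where
    open ≡-Reasoning
    c = n * (n * 1)
    d = n ^ m * ∑ (allFin n) (λ x → ∑ (allFin n) (g x))
    term : Fin m → Fin m → (Fin m → Fin n) → ℕ
    term i j φ = distinct i j * g (φ i) (φ j)

  ∑ᶠ-degreeSum : ∀ m (H : Graph n) →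
    n * (n * 1) * ∑ᶠ m (λ φ → degreeSum (pullback H φ)) ≡ n ^ m * degreeSum H * (m * pred m)
  ∑ᶠ-degreeSum m H = trans
    (cong (n * (n * 1) *_) (∑ᶠ-cong m λ φ → ∑-cong (allFin m) λ i → ∑-cong (allFin m) λ j → loopless φ i j))
    (off-diagonal-sum m (λ x y → 𝟙 (adj H x y)))
    where
    loopless : ∀ (φ : Fin m → Fin n) i j →
               𝟙 (adj H (φ i) (φ j)) ≡ distinct i j * 𝟙 (adj H (φ i) (φ j))
    loopless φ i j with i Fin.≟ j
    ... | yes refl = cong 𝟙 (irrefl H (φ i))
    ... | no _     = ≡.sym (+-identityʳ _)

  collisions : ∀ {m} → (Fin m → Fin n) → ℕ
  collisions {m} φ = ∑ (allFin m) λ i → ∑ (allFin m) λ j → distinct i j * equal (φ i) (φ j)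

  -- Exactly `n` of the ordered pairs of vertices have equal entries, so two coordinates collide
  -- with probability 1/n.
  ∑ᶠ-collisions : ∀ m → n * (n * 1) * ∑ᶠ m collisions ≡ n ^ m * n * (m * pred m)
  ∑ᶠ-collisions m = trans (off-diagonal-sum m equal)
    (cong (λ s → n ^ m * s * (m * pred m))
      (trans (∑-cong (allFin n) ∑-equal) (trans (∑-allFin-const n 1) (*-identityʳ n))))

  collisionless⇒injective : ∀ {m} {φ : Fin m → Fin n} → collisions φ ≡ 0 → ∀ {i j} → φ i ≡ φ j → i ≡ j
  collisionless⇒injective {m} {φ} none {i} {j} φi≡φj with i Fin.≟ j
  ... | yes i≡j = i≡j
  ... | no  i≢j = contradiction (begin
    1                                    ≡⟨ cong₂ _*_ (distinct-≢ i≢j)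
                                             (trans (cong (equal (φ i)) (≡.sym φi≡φj)) (equal-refl (φ i))) ⟨
    distinct i j * equal (φ i) (φ j)     ≤⟨ term≤∑ (λ j → distinct i j * equal (φ i) (φ j)) j ⟩
    ∑ (allFin m) (λ j → distinct i j * equal (φ i) (φ j))
                                         ≤⟨ term≤∑ (λ i → ∑ (allFin m) λ j → distinct i j * equal (φ i) (φ j)) i ⟩
    collisions φ                         ≡⟨ none ⟩
    0                                    ∎) λ ()
    where open ≤-Reasoning

  module _ (T : Fin n → Fin n → Fin n → ℕ) where

    triples : ∀ {m} → (Fin m → Fin n) → ℕ
    triples {m} φ = ∑ (allFin m) λ i → ∑ (allFin m) λ j → ∑ (allFin m) λ l →
      distinct i j * (distinct i l * (distinct j l * T (φ i) (φ j) (φ l)))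

    no-triples : ∀ {m} {φ : Fin m → Fin n} → triples φ ≡ 0 → ∀ i j l → i ≢ j → i ≢ l → j ≢ l → T (φ i) (φ j) (φ l) ≡ 0
    no-triples {m} {φ} none i j l i≢j i≢l j≢l = n≤0⇒n≡0 (begin
      T (φ i) (φ j) (φ l)                  ≡⟨ trans (*-identityˡ _) (trans (*-identityˡ _) (*-identityˡ _)) ⟨
      1 * (1 * (1 * T (φ i) (φ j) (φ l)))  ≡⟨ cong₂ _*_ (distinct-≢ i≢j) (cong₂ _*_ (distinct-≢ i≢l)
                                               (cong (_* T (φ i) (φ j) (φ l)) (distinct-≢ j≢l))) ⟨
      term i j l                           ≤⟨ term≤∑ (term i j) l ⟩
      ∑ (allFin m) (term i j)              ≤⟨ term≤∑ (λ j → ∑ (allFin m) (term i j)) j ⟩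
      ∑ (allFin m) (λ j → ∑ (allFin m) (term i j))
                                           ≤⟨ term≤∑ (λ i → ∑ (allFin m) λ j → ∑ (allFin m) (term i j)) i ⟩
      triples φ                            ≡⟨ none ⟩
      0                                    ∎)
      where
      open ≤-Reasoning
      term : Fin m → Fin m → Fin m → ℕ
      term i j l = distinct i j * (distinct i l * (distinct j l * T (φ i) (φ j) (φ l)))

    module _ (d : ℕ) (T-sparse : ∀ x y → ∑ (allFin n) (T x y) ≤ d) where

      -- By `marginal₃` and `T-sparse`, a triple of distinct coordinates has expected weight at most
      -- d/n, and there are at most `m * (m * m)` of them.
      ∑ᶠ-triples : ∀ m → n * (n * (n * 1)) * ∑ᶠ m triples ≤ m * (m * (m * (n ^ m * (n * (n * d)))))
      ∑ᶠ-triples m = begin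
        c * ∑ᶠ m triples
          ≡⟨ cong (c *_) (trans (∑ᶠ-∑-swap m _ (allFin m)) (∑-cong (allFin m) λ i →
                          trans (∑ᶠ-∑-swap m _ (allFin m)) (∑-cong (allFin m) λ j →
                          ∑ᶠ-∑-swap m (term i j) (allFin m)))) ⟩
        c * ∑ (allFin m) (λ i → ∑ (allFin m) λ j → ∑ (allFin m) λ l → ∑ᶠ m (term i j l))
          ≡⟨ trans (≡.sym (∑-distrib-* c _ (allFin m))) (∑-cong (allFin m) λ i →
             trans (≡.sym (∑-distrib-* c _ (allFin m))) (∑-cong (allFin m) λ j →
             ≡.sym (∑-distrib-* c _ (allFin m)))) ⟩
        ∑ (allFin m) (λ i → ∑ (allFin m) λ j → ∑ (allFin m) λ l → c * ∑ᶠ m (term i j l))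
          ≤⟨ ∑-allFin-≤-const _ (λ i → ∑-allFin-≤-const _ (λ j → ∑-allFin-≤-const _ (bound i j))) ⟩
        m * (m * (m * (n ^ m * (n * (n * d))))) ∎
        where
        open ≤-Reasoning
        c = n * (n * (n * 1))
        term : Fin m → Fin m → Fin m → (Fin m → Fin n) → ℕ
        term i j l φ = distinct i j * (distinct i l * (distinct j l * T (φ i) (φ j) (φ l)))

        vanishing : ∀ {s} → c * ∑ᶠ m (λ _ → 0) ≤ s
        vanishing = ≤-trans (≤-reflexive (trans (cong (c *_) (trans (∑ᶠ-const m 0) (*-zeroʳ (n ^ m))))
                                               (*-zeroʳ c))) z≤n

        bound : ∀ i j l → c * ∑ᶠ m (term i j l) ≤ n ^ m * (n * (n * d))
        bound i j l with i Fin.≟ j | i Fin.≟ l | j Fin.≟ l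
        ... | yes _ | _     | _     = vanishing
        ... | no _  | yes _ | _     = vanishing
        ... | no _  | no _  | yes _ = vanishing
        ... | no i≢j | no i≢l | no j≢l = begin
          c * ∑ᶠ m (λ φ → 1 * (1 * (1 * T (φ i) (φ j) (φ l))))
            ≡⟨ cong (c *_) (∑ᶠ-cong m λ φ → trans (*-identityˡ _) (trans (*-identityˡ _) (*-identityˡ _))) ⟩
          c * ∑ᶠ m (λ φ → T (φ i) (φ j) (φ l))
            ≡⟨ marginal₃ T i j l i≢j i≢l j≢l ⟩
          n ^ m * ∑ (allFin n) (λ x → ∑ (allFin n) λ y → ∑ (allFin n) (T x y))
            ≤⟨ *-monoʳ-≤ (n ^ m) (∑-allFin-≤-const _ λ x → ∑-allFin-≤-const _ (T-sparse x)) ⟩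
          n ^ m * (n * (n * d)) ∎

      -- On average `a * Q + D * bad φ` is below `1 + b * E φ`, so some `φ` satisfies this. The
      -- penalty `D` then forces `bad φ` to vanish, and what remains is the density bound. The
      -- summand 1 is the slack that absorbs the bad events.
      sample : ∀ m (a b : ℕ) (H : Graph n) →
        suc (b * (m * m)) * (m * m + m * (m * (m * d))) < n →
        a * (n * n) ≤ b * degreeSum H →
        ∃ λ (φ : Fin m → Fin n) →
          (∀ {i j} → φ i ≡ φ j → i ≡ j) ×
          (∀ i j l → i ≢ j → i ≢ l → j ≢ l → T (φ i) (φ j) (φ l) ≡ 0) ×
          a * (m * pred m) ≤ b * degreeSum (pullback H φ)
      sample m a b H n-large dense =
        let φ , lt = ∑ᶠ-<⇒∃< m (λ φ → a * Q + D * bad φ) (λ φ → 1 + b * E φ) averaged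
            good   = s≤s⁻¹ lt
        in  φ
          , collisionless⇒injective (m+n≡0⇒m≡0 (collisions φ) (bad≡0 φ good))
          , no-triples (m+n≡0⇒n≡0 (collisions φ) (bad≡0 φ good))
          , ≤-trans (m≤m+n _ _) good
        where
        open ≤-Reasoning
        D = suc (b * (m * m))
        Q = m * pred m
        E bad : (Fin m → Fin n) → ℕ
        E φ = degreeSum (pullback H φ)
        bad φ = collisions φ + triples φ

        -- The weight D exceeds every possible value of b * E.
        bad≡0 : ∀ φ → a * Q + D * bad φ ≤ b * E φ → bad φ ≡ 0
        bad≡0 φ good with bad φ
        ... | zero  = refl
        ... | suc k = contradiction (begin-strict
          b * (m * m)         <⟨ ≤-refl ⟩
          D                   ≤⟨ m≤m*n D (suc k) ⟩
          D * suc k           ≤⟨ m≤n+m _ (a * Q) ⟩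
          a * Q + D * suc k   ≤⟨ good ⟩
          b * E φ             ≤⟨ *-monoʳ-≤ b (degreeSum≤n*n (pullback H φ)) ⟩
          b * (m * m)         ∎) (<-irrefl refl)

        averaged : ∑ᶠ m (λ φ → a * Q + D * bad φ) < ∑ᶠ m (λ φ → 1 + b * E φ)
        averaged = begin-strict
          ∑ᶠ m (λ φ → a * Q + D * bad φ)
            ≡⟨ ∑ᶠ-distrib-+ m (λ _ → a * Q) (λ φ → D * bad φ) ⟩
          ∑ᶠ m (λ φ → a * Q) + ∑ᶠ m (λ φ → D * bad φ)
            ≡⟨ cong₂ _+_ (∑ᶠ-const m (a * Q))
                 (trans (∑ᶠ-distrib-* m D bad) (cong (D *_) (∑ᶠ-distrib-+ m collisions triples))) ⟩
          n ^ m * (a * Q) + D * (∑ᶠ m collisions + ∑ᶠ m triples)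
            <⟨ averaging-arithmetic n m a b d (degreeSum H) _ _ _ {{>-nonZero (≤-<-trans z≤n n-large)}}
                 n-large dense (∑ᶠ-collisions m) (∑ᶠ-triples m) (∑ᶠ-degreeSum m H) ⟩
          n ^ m * 1 + b * ∑ᶠ m E
            ≡⟨ cong₂ _+_ (∑ᶠ-const m 1) (∑ᶠ-distrib-* m b E) ⟨
          ∑ᶠ m (λ _ → 1) + ∑ᶠ m (λ φ → b * E φ)
            ≡⟨ ∑ᶠ-distrib-+ m (λ _ → 1) (λ φ → b * E φ) ⟨
          ∑ᶠ m (λ φ → 1 + b * E φ) ∎

-- Pruning and growing complete multipartite graphs

∑-─ : ∀ {A : Set} {P : A → Set} (f : A → ℕ) {xs} (p : Any P xs) →
      ∑ xs f ≡ f (Any.lookup p) + ∑ (xs ─ p) f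
∑-─ f (here _)                = refl
∑-─ f {x ∷ xs} (there p) = trans (cong (f x +_) (∑-─ f p))
                                 (left-comm (f x) (f (Any.lookup p)) (∑ (xs ─ p) f))
  where
  left-comm : ∀ a b c → a + (b + c) ≡ b + (a + c)
  left-comm = solve-∀

AllPairs-─ : ∀ {A : Set} {P : A → Set} {R : A → A → Set} {xs} (p : Any P xs) →
             AllPairs R xs → AllPairs R (xs ─ p)
AllPairs-─ (here _)  (_ ∷ rs) = rs
AllPairs-─ (there p) (r ∷ rs) = All.─⁺ p r ∷ AllPairs-─ p rs

lookup-satisfies : ∀ {A : Set} {P : A → Set} {xs} (p : Any P xs) → P (Any.lookup p)
lookup-satisfies (here px) = px
lookup-satisfies (there p) = lookup-satisfies p

∣take∣ : ∀ {A : Set} t {xs : List A} → t ≤ length xs → length (take t xs) ≡ t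
∣take∣ t {xs} t≤ = trans (length-take t xs) (m≤n⇒m⊓n≡m t≤)

length-filter≡∑ : ∀ {A : Set} {P : A → Set} (P? : ∀ x → Dec (P x)) xs →
                  length (filter P? xs) ≡ ∑ xs (λ x → 𝟙 (does (P? x)))
length-filter≡∑ P? []       = refl
length-filter≡∑ P? (x ∷ xs) with does (P? x)
... | true  = cong suc (length-filter≡∑ P? xs)
... | false = length-filter≡∑ P? xs

length-concat : ∀ {A : Set} {t} {Ps : List (List A)} → All (λ P → length P ≡ t) Ps →
                length (concat Ps) ≡ length Ps * t
length-concat []                      = refl
length-concat {Ps = P ∷ _} (eq ∷ eqs) = trans (length-++ P) (cong₂ _+_ eq (length-concat eqs))

∑-≤-const-All : ∀ {A : Set} {f : A → ℕ} {c xs} → All (λ x → f x ≤ c) xs → ∑ xs f ≤ length xs * c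
∑-≤-const-All {c = c} {xs} all = ≤-trans (∑-mono-All all) (≤-reflexive (∑-const xs c))

-- How many vertices force a K_{r+1}(t) at density 1 - 1/r + 1/(r(q+1)).
threshold : ℕ → ℕ → ℕ → ℕ
threshold zero    q t = t
threshold (suc r) q t = threshold r q (2 * suc q * t) + suc (2 * q) * (t * 2 ^ (suc r * (2 * suc q * t)))

module _ {n : ℕ} (H : Graph n) where

  deg nondeg : Fin n → List (Fin n) → ℕ
  deg    v xs = ∑ xs λ u → 𝟙 (adj H v u)
  nondeg v xs = ∑ xs λ u → 𝟙 (not (adj H v u))

  deg+nondeg : ∀ v xs → deg v xs + nondeg v xs ≡ length xs
  deg+nondeg v xs = trans (≡.sym (∑-distrib-+ _ _ xs))
    (trans (∑-cong xs λ u → 𝟙-+-not (adj H v u)) (trans (∑-const xs 1) (*-identityʳ _)))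

  deg≤length : ∀ v xs → deg v xs ≤ length xs
  deg≤length v xs = ≤-trans (m≤m+n _ _) (≤-reflexive (deg+nondeg v xs))

  degrees : List (Fin n) → ℕ
  degrees xs = ∑ xs λ v → deg v xs

  degrees≤square : ∀ xs → degrees xs ≤ length xs * length xs
  degrees≤square xs = ≤-trans (∑-mono xs λ v → deg≤length v xs) (≤-reflexive (∑-const xs (length xs)))

  -- Deleting `v` removes its row and its column from the adjacency matrix, and each contributes at
  -- most `deg v xs`.
  degrees-─ : ∀ {P : Fin n → Set} {xs} (p : Any P xs) →
              degrees xs ≤ 2 * deg (Any.lookup p) xs + degrees (xs ─ p)
  degrees-─ {xs = xs} p = begin
    degrees xs
      ≡⟨ ∑-─ (λ u → deg u xs) p ⟩
    deg v xs + ∑ xs′ (λ u → deg u xs)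
      ≡⟨ cong (deg v xs +_) (∑-cong xs′ λ u → ∑-─ (λ w → 𝟙 (adj H u w)) p) ⟩
    deg v xs + ∑ xs′ (λ u → 𝟙 (adj H u v) + deg u xs′)
      ≡⟨ cong (deg v xs +_) (∑-distrib-+ _ _ xs′) ⟩
    deg v xs + (∑ xs′ (λ u → 𝟙 (adj H u v)) + degrees xs′)
      ≡⟨ cong (λ s → deg v xs + (s + degrees xs′)) (∑-cong xs′ λ u → cong 𝟙 (sym H u v)) ⟩
    deg v xs + (deg v xs′ + degrees xs′)
      ≤⟨ +-monoʳ-≤ (deg v xs) (+-monoˡ-≤ (degrees xs′)
           (≤-trans (m≤n+m _ _) (≤-reflexive (≡.sym (∑-─ (λ w → 𝟙 (adj H v w)) p))))) ⟩
    deg v xs + (deg v xs + degrees xs′)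
      ≡⟨ regroup (deg v xs) (degrees xs′) ⟩
    2 * deg v xs + degrees xs′ ∎
    where
    open ≤-Reasoning
    v = Any.lookup p
    xs′ = xs ─ p
    regroup : ∀ a b → a + (a + b) ≡ 2 * a + b
    regroup = solve-∀

  MinDegree : ℕ → ℕ → List (Fin n) → Set
  MinDegree a b xs = All (λ v → a * length xs ≤ b * deg v xs) xs

  -- Deleting a vertex of degree < (a/b)s from s vertices preserves the surplus over (a/b)s(s+1).
  prune : ∀ a b M s xs → .{{NonZero b}} → length xs ≡ s → Unique xs →
          a * (s * suc s) + b * (M * M) ≤ b * degrees xs →
          ∃ λ ys → M ≤ length ys × Unique ys × MinDegree a b ys
  prune a b M s xs ∣xs∣≡s unique surplus with All.all? (λ v → a * length xs ≤? b * deg v xs) xs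
  ... | yes minDegree = xs , ≮⇒≥ (λ ∣xs∣<M → <⇒≱ (*-mono-< ∣xs∣<M ∣xs∣<M) M*M≤) , unique , minDegree
    where
    M*M≤ : M * M ≤ length xs * length xs
    -- The term `b * (M * M)` of the surplus survives all deletions, and a list carries at most
    -- `length xs * length xs` adjacent pairs; so pruning stops before fewer than `M` vertices are
    -- left.
    M*M≤ = *-cancelˡ-≤ b (≤-trans (m≤n+m _ _) (≤-trans surplus (*-monoʳ-≤ b (degrees≤square xs))))
  ... | no ¬minDegree with All.¬All⇒Any¬ (λ v → a * length xs ≤? b * deg v xs) xs ¬minDegree
  prune a b M zero (_ ∷ _) () unique surplus | no _ | _
  prune a b M (suc s) xs ∣xs∣≡s unique surplus | no _ | p =
    prune a b M s (xs ─ p) (suc-injective (trans (≡.sym (length-removeAt′ xs (Any.index p))) ∣xs∣≡s))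
      (AllPairs-─ p unique) (+-cancelʳ-≤ (2 * (a * suc s)) _ _ surplus′)
    where
    open ≤-Reasoning
    split : ∀ a b s M → a * (s * suc s) + b * (M * M) + 2 * (a * suc s) ≡
                        a * (suc s * suc (suc s)) + b * (M * M)
    split = solve-∀
    regroup : ∀ b d e → b * (2 * d + e) ≡ b * e + 2 * (b * d)
    regroup = solve-∀
    surplus′ : a * (s * suc s) + b * (M * M) + 2 * (a * suc s) ≤ b * degrees (xs ─ p) + 2 * (a * suc s)
    surplus′ = begin
      a * (s * suc s) + b * (M * M) + 2 * (a * suc s)         ≡⟨ split a b s M ⟩
      a * (suc s * suc (suc s)) + b * (M * M)                 ≤⟨ surplus ⟩
      b * degrees xs                                          ≤⟨ *-monoʳ-≤ b (degrees-─ p) ⟩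
      b * (2 * deg (Any.lookup p) xs + degrees (xs ─ p))      ≡⟨ regroup b (deg (Any.lookup p) xs) _ ⟩
      b * degrees (xs ─ p) + 2 * (b * deg (Any.lookup p) xs)
        ≤⟨ +-monoʳ-≤ (b * degrees (xs ─ p)) (*-monoʳ-≤ 2 (<⇒≤ (≰⇒> (lookup-satisfies p)))) ⟩
      b * degrees (xs ─ p) + 2 * (a * length xs)
        ≡⟨ cong (λ l → b * degrees (xs ─ p) + 2 * (a * l)) ∣xs∣≡s ⟩
      b * degrees (xs ─ p) + 2 * (a * suc s)                  ∎

  neighbours nonneighbours : Fin n → List (Fin n) → List (Fin n)
  neighbours    u = filter λ w → adj H u w Bool.≟ true
  nonneighbours u = filter λ w → adj H u w Bool.≟ false

  ∣neighbours∣ : ∀ u ws → length (neighbours u ws) ≡ deg u ws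
  ∣neighbours∣ u []       = refl
  ∣neighbours∣ u (w ∷ ws) with adj H u w
  ... | true  = cong suc (∣neighbours∣ u ws)
  ... | false = ∣neighbours∣ u ws

  ∣nonneighbours∣ : ∀ u ws → length (nonneighbours u ws) ≡ nondeg u ws
  ∣nonneighbours∣ u []       = refl
  ∣nonneighbours∣ u (w ∷ ws) with adj H u w
  ... | true  = ∣nonneighbours∣ u ws
  ... | false = cong suc (∣nonneighbours∣ u ws)

  Uniform : List (Fin n) → Fin n → Set
  Uniform ws u = ∃ λ β → All (λ w → adj H u w ≡ β) ws

  -- Pigeonhole: each `u` keeps the neighbours or the nonneighbours in `ws`, whichever is large
  -- enough, at the cost of a factor 2. The predicate `D` carries known properties along to the
  -- subset.
  uniform-subset : ∀ {D : Fin n → Set} t us ws → t * 2 ^ length us ≤ length ws → Unique ws → All D ws →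
    ∃ λ ws′ → t ≤ length ws′ × Unique ws′ × All D ws′ × All (Uniform ws′) us
  uniform-subset t [] ws large unique allD =
    ws , ≤-trans (≤-reflexive (≡.sym (*-identityʳ t))) large , unique , allD , []
  uniform-subset {D} t (u ∷ us) ws large unique allD with t * 2 ^ length us ≤? length (neighbours u ws)
  ... | yes half =
    let ws′ , size , unique′ , all , uniform =
          uniform-subset {λ w → D w × adj H u w ≡ true} t us (neighbours u ws) half
            (AllPairs.filter⁺ _ unique) (All.zip (All.filter⁺ _ allD , All.all-filter _ ws))
    in  ws′ , size , unique′ , All.map proj₁ all , (true , All.map proj₂ all) ∷ uniform
  ... | no ¬half =
    let ws′ , size , unique′ , all , uniform =
          uniform-subset {λ w → D w × adj H u w ≡ false} t us (nonneighbours u ws) half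
            (AllPairs.filter⁺ _ unique) (All.zip (All.filter⁺ _ allD , All.all-filter _ ws))
    in  ws′ , size , unique′ , All.map proj₁ all , (false , All.map proj₂ all) ∷ uniform
    where
    open ≤-Reasoning
    h = t * 2 ^ length us
    double : ∀ t p → t * p + t * p ≡ t * (2 * p)
    double = solve-∀
    half : h ≤ length (nonneighbours u ws)
    half = +-cancelˡ-≤ h _ _ (begin
      h + h                                                          ≡⟨ double t (2 ^ length us) ⟩
      t * (2 * 2 ^ length us)                                        ≤⟨ large ⟩
      length ws                                                      ≡⟨ deg+nondeg u ws ⟨
      deg u ws + nondeg u ws                                         ≡⟨ cong₂ _+_ (∣neighbours∣ u ws)
                                                                                   (∣nonneighbours∣ u ws) ⟨
      length (neighbours u ws) + length (nonneighbours u ws)         ≤⟨ +-monoˡ-≤ _ (<⇒≤ (≰⇒> ¬half)) ⟩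
      h + length (nonneighbours u ws)                                ∎)

  Joined : List (Fin n) → List (Fin n) → Set
  Joined P Q = All (λ w → All (λ u → adj H w u ≡ true) P) Q

  -- A complete multipartite subgraph, where edges inside a part are allowed. Disjointness of the
  -- parts is implied by `joined`, as no vertex is adjacent to itself.
  record Multipartite (xs : List (Fin n)) (t : ℕ) (Ps : List (List (Fin n))) : Set where
    field
      sizes  : All (λ P → length P ≡ t) Ps
      unique : All Unique Ps
      within : All (All (_∈ xs)) Ps
      joined : AllPairs Joined Ps

  open Multipartite

  -- A vertex with fewer than t neighbours in some part misses at least (2q+1)t vertices of the parts, so
  -- counting nonadjacent pairs shows that such vertices make up at most 2q/(2q+1) of xs.
  module Extension (r q t : ℕ) .{{_ : NonZero t}} (xs : List (Fin n))
    (uniqueVertices : Unique xs)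
    (fewNonneighbours : All (λ u → suc r * suc q * nondeg u xs ≤ q * length xs) xs)
    (Ps : List (List (Fin n))) (∣Ps∣≡1+r : length Ps ≡ suc r)
    (multipartite : Multipartite xs (2 * suc q * t) Ps)
    where

    private
      s T c : ℕ
      s = length xs
      T = 2 * suc q * t
      c = suc (2 * q) * t

    Good : Fin n → Set
    Good w = All (λ P → t ≤ deg w P) Ps

    good? : ∀ w → Dec (Good w)
    good? w = All.all? (λ P → t ≤? deg w P) Ps

    goods : List (Fin n)
    goods = filter good? xs

    bads : ℕ
    bads = ∑ xs λ w → 𝟙 (not (does (good? w)))

    goods+bads : length goods + bads ≡ s
    goods+bads = begin
      length goods + bads                              ≡⟨ cong (_+ bads) (length-filter≡∑ good? xs) ⟩
      ∑ xs (λ w → 𝟙 (does (good? w))) + bads           ≡⟨ ∑-distrib-+ _ _ xs ⟨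
      ∑ xs (λ w → 𝟙 (does (good? w)) + 𝟙 (not (does (good? w))))
                                                       ≡⟨ ∑-cong xs (λ w → 𝟙-+-not (does (good? w))) ⟩
      ∑ xs (λ _ → 1)                                   ≡⟨ ∑-const xs 1 ⟩
      s * 1                                            ≡⟨ *-identityʳ s ⟩
      s                                                ∎
      where open ≡-Reasoning

    nonadjacent : Fin n → ℕ
    nonadjacent w = ∑ Ps (nondeg w)

    bad⇒nonadjacent : ∀ w → ¬ Good w → c ≤ nonadjacent w
    bad⇒nonadjacent w ¬good with All.¬All⇒Any¬ (λ P → t ≤? deg w P) Ps ¬good
    ... | p with find p
    ... | P , P∈Ps , t≰deg = ≤-trans (+-cancelˡ-≤ t _ _ (begin
      t + c                     ≡⟨ total q t ⟩
      T                         ≡⟨ All.lookup (sizes multipartite) P∈Ps ⟨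
      length P                  ≡⟨ deg+nondeg w P ⟨
      deg w P + nondeg w P      ≤⟨ +-monoˡ-≤ (nondeg w P) (<⇒≤ (≰⇒> t≰deg)) ⟩
      t + nondeg w P            ∎)) (member≤∑ (nondeg w) P∈Ps)
      where
      open ≤-Reasoning
      total : ∀ q t → t + suc (2 * q) * t ≡ 2 * suc q * t
      total = solve-∀

    bads-bound : c * bads ≤ ∑ xs nonadjacent
    bads-bound = ≤-trans (≤-reflexive (≡.sym (∑-distrib-* c _ xs))) (∑-mono xs pointwise)
      where
      pointwise : ∀ w → c * 𝟙 (not (does (good? w))) ≤ nonadjacent w
      pointwise w with good? w
      ... | yes _    = ≤-trans (≤-reflexive (*-zeroʳ c)) z≤n
      ... | no ¬good = ≤-trans (≤-reflexive (*-identityʳ c)) (bad⇒nonadjacent w ¬good)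

    nonadjacent-swap : ∑ xs nonadjacent ≡ ∑ Ps λ P → ∑ P λ u → nondeg u xs
    nonadjacent-swap = trans (∑-swap nondeg xs Ps) (∑-cong Ps λ P →
      trans (∑-swap (λ w u → 𝟙 (not (adj H w u))) xs P)
            (∑-cong P λ u → ∑-cong xs λ w → cong (𝟙 ∘ not) (sym H w u)))

    -- Counting from the side of the parts, each of the `suc r * T` vertices there has few
    -- nonneighbours in `xs`. The factor `suc r * suc q` of that hypothesis cancels against the
    -- number of these vertices.
    nonadjacent-bound : ∑ xs nonadjacent ≤ 2 * t * (q * s)
    nonadjacent-bound = *-cancelˡ-≤ (suc r * suc q) (begin
      d * ∑ xs nonadjacent
        ≡⟨ cong (d *_) nonadjacent-swap ⟩
      d * ∑ Ps (λ P → ∑ P λ u → nondeg u xs)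
        ≡⟨ trans (≡.sym (∑-distrib-* d _ Ps)) (∑-cong Ps λ P → ≡.sym (∑-distrib-* d _ P)) ⟩
      ∑ Ps (λ P → ∑ P λ u → d * nondeg u xs)
        ≤⟨ ∑-≤-const-All (All.zipWith (λ (P⊆xs , ∣P∣) →
             ≤-trans (∑-≤-const-All (All.map (All.lookup fewNonneighbours) P⊆xs))
                     (≤-reflexive (cong (_* (q * s)) ∣P∣)))
             (within multipartite , sizes multipartite)) ⟩
      length Ps * (T * (q * s))
        ≡⟨ cong (_* (T * (q * s))) ∣Ps∣≡1+r ⟩
      suc r * (T * (q * s))
        ≡⟨ regroup r q t s ⟩
      d * (2 * t * (q * s)) ∎)
      where
      open ≤-Reasoning
      d = suc r * suc q
      regroup : ∀ r q t s → suc r * (2 * suc q * t * (q * s)) ≡ suc r * suc q * (2 * t * (q * s))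
      regroup = solve-∀

    -- The total `c * s` is `t * s + 2 * t * (q * s)`, and bad vertices use up at most the second
    -- summand.
    many-goods : s ≤ suc (2 * q) * length goods
    many-goods = *-cancelˡ-≤ t (+-cancelʳ-≤ (2 * t * (q * s)) _ _ (begin
      t * s + 2 * t * (q * s)                                  ≡⟨ factor t q s ⟩
      c * s                                                    ≡⟨ cong (c *_) goods+bads ⟨
      c * (length goods + bads)                                ≡⟨ *-distribˡ-+ c (length goods) bads ⟩
      c * length goods + c * bads                              ≤⟨ +-monoʳ-≤ (c * length goods)
                                                                   (≤-trans bads-bound nonadjacent-bound) ⟩
      c * length goods + 2 * t * (q * s)                       ≡⟨ cong (_+ 2 * t * (q * s)) (regroup q t (length goods)) ⟩
      t * (suc (2 * q) * length goods) + 2 * t * (q * s)       ∎))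
      where
      open ≤-Reasoning
      factor : ∀ t q s → t * s + 2 * t * (q * s) ≡ suc (2 * q) * t * s
      factor = solve-∀
      regroup : ∀ q t g → suc (2 * q) * t * g ≡ t * (suc (2 * q) * g)
      regroup = solve-∀

    -- Among the good vertices choose a set `ws` that every vertex of the parts sees uniformly. A
    -- single `w₀` in `ws` has `t` neighbours in each part, and by uniformity these are adjacent to
    -- all of `ws`, so `ws` supplies the new part.
    extend : suc (2 * q) * (t * 2 ^ (suc r * T)) ≤ s →
             ∃ λ Qs → length Qs ≡ suc (suc r) × Multipartite xs t Qs
    extend large with uniform-subset {λ w → w ∈ xs × Good w} t (concat Ps) goods enough
                        (AllPairs.filter⁺ good? uniqueVertices)
                        (All.zip (All.filter⁺ good? (All.tabulate id) , All.all-filter good? xs))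
      where
      open ≤-Reasoning
      enough : t * 2 ^ length (concat Ps) ≤ length goods
      enough = *-cancelˡ-≤ (suc (2 * q)) (begin
        suc (2 * q) * (t * 2 ^ length (concat Ps))
          ≡⟨ cong (λ l → suc (2 * q) * (t * 2 ^ l))
               (trans (length-concat (sizes multipartite)) (cong (_* T) ∣Ps∣≡1+r)) ⟩
        suc (2 * q) * (t * 2 ^ (suc r * T))          ≤⟨ large ⟩
        s                                            ≤⟨ many-goods ⟩
        suc (2 * q) * length goods                   ∎)
    ... | [] , size , _ = contradiction (n≤0⇒n≡0 size) (≢-nonZero⁻¹ t)
    ... | ws@(w₀ ∷ _) , size , uniqueWs , wsGood , uniform =
      take t ws ∷ map shrink Ps , cong suc (trans (length-map shrink Ps) ∣Ps∣≡1+r) , record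
        { sizes  = ∣take∣ t size ∷ All.map⁺ (All.map
                     (λ {P} t≤deg → ∣take∣ t (≤-trans t≤deg (≤-reflexive (≡.sym (∣neighbours∣ w₀ P)))))
                     (proj₂ (All.head wsGood)))
        ; unique = AllPairs.take⁺ t uniqueWs ∷ All.map⁺ (All.map
                     (AllPairs.take⁺ t ∘ AllPairs.filter⁺ _) (unique multipartite))
        ; within = All.take⁺ t (All.map proj₁ wsGood) ∷ All.map⁺ (All.map shrink-All (within multipartite))
        ; joined = All.map⁺ (All.map (λ {P} → joined-to-ws {P}) (All.concat⁻ uniform))
                 ∷ AllPairs.map⁺ (AllPairs.map (shrink-All ∘ All.map shrink-All) (joined multipartite))
        }
      where
      shrink : List (Fin n) → List (Fin n)
      shrink P = take t (neighbours w₀ P)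

      shrink-All : ∀ {D : Fin n → Set} {P} → All D P → All D (shrink P)
      shrink-All = All.take⁺ t ∘ All.filter⁺ _

      joined-to-ws : ∀ {P} → All (Uniform ws) P → Joined (take t ws) (shrink P)
      joined-to-ws {P} uniformP = All.take⁺ t (All.zipWith
        (λ { {u} ((β , u~w₀ ∷ u~ws) , w₀~u) → All.take⁺ t (All.map
             (λ u~w → trans u~w (trans (≡.sym u~w₀) (trans (sym H u w₀) w₀~u))) (u~w₀ ∷ u~ws)) })
        (All.filter⁺ _ uniformP , All.all-filter (λ w → adj H w₀ w Bool.≟ true) P))

  -- Induction on `r`: parts of size `2 * suc q * t` are requested first and then shrunk to size `t`
  -- when the new part is added. The bound on nonneighbours for `suc r` implies the one for `r`.
  multipartite-exists : ∀ r q t .{{_ : NonZero t}} xs → threshold r q t ≤ length xs → Unique xs →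
    All (λ u → r * suc q * nondeg u xs ≤ q * length xs) xs →
    ∃ λ Ps → length Ps ≡ suc r × Multipartite xs t Ps
  multipartite-exists zero q t xs large uniqueXs _ = take t xs ∷ [] , refl , record
    { sizes  = ∣take∣ t large ∷ []
    ; unique = AllPairs.take⁺ t uniqueXs ∷ []
    ; within = All.take⁺ t (All.tabulate id) ∷ []
    ; joined = [] ∷ []
    }
  multipartite-exists (suc r) q t xs large uniqueXs few =
    let Ps , ∣Ps∣ , multipartite = multipartite-exists r q (2 * suc q * t) {{m*n≢0 (2 * suc q) t}} xs
          (m+n≤o⇒m≤o _ large) uniqueXs
          (All.map (λ {u} → ≤-trans (*-monoˡ-≤ (nondeg u xs) (*-monoˡ-≤ (suc q) (n≤1+n r)))) few)
    in  Extension.extend r q t xs uniqueXs few Ps ∣Ps∣ multipartite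
          (m+n≤o⇒n≤o (threshold r q (2 * suc q * t)) large)

-- Embedding into multipartite graphs and the Erdős-Stone theorem.

AllPairs-lookup : ∀ {A : Set} {R : A → A → Set} {xs : List A} → AllPairs R xs → ∀ {i j} → i ≢ j →
                  R (lookup xs i) (lookup xs j) ⊎ R (lookup xs j) (lookup xs i)
AllPairs-lookup (_ ∷ _)  {zero}  {zero}  i≢j = contradiction refl i≢j
AllPairs-lookup (r ∷ _)  {zero}  {suc j} _   = inj₁ (All.lookup r (∈-lookup j))
AllPairs-lookup (r ∷ _)  {suc i} {zero}  _   = inj₂ (All.lookup r (∈-lookup i))
AllPairs-lookup (_ ∷ rs) {suc i} {suc j} i≢j = AllPairs-lookup rs (i≢j ∘ cong suc)

lookup-unique : ∀ {A : Set} {xs : List A} → Unique xs → ∀ {i j} → lookup xs i ≡ lookup xs j → i ≡ j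
lookup-unique unique {i} {j} eq with i Fin.≟ j
... | yes i≡j = i≡j
... | no  i≢j with AllPairs-lookup unique i≢j
...   | inj₁ neq = contradiction eq neq
...   | inj₂ neq = contradiction (≡.sym eq) neq

-- Vertex `a` goes to position `a` of the part named by its colour: equal colours give different
-- positions, different colours give adjacent images.
multipartite⇒copy : ∀ {v n} (G : Graph v) (H : Graph n) {xs t Ps} → v ≤ t → Multipartite H xs t Ps →
                    Colorable (length Ps) G → Copy G H
multipartite⇒copy {v} {n} G H {xs} {t} {Ps} v≤t multipartite (colour , proper) = record
  { φ    = λ a → vertex (colour a) a
  ; inj  = λ {a} {b} → injective a b
  ; pres = λ a b a~b → vertices-adjacent (proper a b a~b) a b
  }
  where
  open Multipartite multipartite

  position : ∀ i → Fin v → Fin (length (lookup Ps i))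
  position i a = Fin.cast (≡.sym (All.lookup sizes (∈-lookup i))) (Fin.inject≤ a v≤t)

  toℕ-position : ∀ i a → toℕ (position i a) ≡ toℕ a
  toℕ-position i a = trans (Fin.toℕ-cast _ (Fin.inject≤ a v≤t)) (Fin.toℕ-inject≤ a v≤t)

  vertex : Fin (length Ps) → Fin v → Fin n
  vertex i a = lookup (lookup Ps i) (position i a)

  vertex-injective : ∀ i {a b} → vertex i a ≡ vertex i b → a ≡ b
  vertex-injective i {a} {b} eq = Fin.toℕ-injective (trans (≡.sym (toℕ-position i a))
    (trans (cong toℕ (lookup-unique (All.lookup unique (∈-lookup i)) eq)) (toℕ-position i b)))

  vertices-adjacent : ∀ {i j} → i ≢ j → ∀ a b → adj H (vertex i a) (vertex j b) ≡ true
  vertices-adjacent {i} {j} i≢j a b with AllPairs-lookup joined i≢j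
  ... | inj₁ ij = trans (sym H _ _) (All.lookup (All.lookup ij (∈-lookup (position j b))) (∈-lookup (position i a)))
  ... | inj₂ ji = All.lookup (All.lookup ji (∈-lookup (position i a))) (∈-lookup (position j b))

  injective : ∀ a b → vertex (colour a) a ≡ vertex (colour b) b → a ≡ b
  injective a b eq with colour a Fin.≟ colour b
  ... | yes same = vertex-injective (colour a)
    (trans eq (cong (λ i → vertex i b) (≡.sym same)))
  -- Equal images in two different parts would be a loop of `H`.
  ... | no  diff = contradiction
    (trans (≡.sym (irrefl H (vertex (colour b) b)))
           (trans (cong (λ x → adj H x (vertex (colour b) b)) (≡.sym eq)) (vertices-adjacent diff a b)))
    λ ()

-- With `a` and `b` as below, the density `suc a / b` exceeds the Turán density r/(r+1) by 2/b. One
-- unit 1/b pays for pruning to relative minimum degree a/b; since `b` is `a + q`, each vertex left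
-- then misses at most a fraction q/b of the rest of the list, itself included, which is less than
-- 1/(r+1).
erdős-stone : ∀ r q v → ∃ λ m → ∀ (H : Graph m) →
  suc (suc (r * suc q)) * (m * pred m) ≤ suc r * suc q * degreeSum H →
  ∀ (G : Graph v) → Colorable (suc (suc r)) G → Copy G H
erdős-stone r q v = m , λ H dense G colouring →
  let ys , large , unique , minDegree = prune H a b M m (allFin m) (length-allFin m) (allFin⁺ m)
                                          (≤-trans surplus dense)
      Ps , ∣Ps∣ , multipartite = multipartite-exists H (suc r) q (suc v) ys large unique
                                  (All.map (λ {u} → few H ys u) minDegree)
  in  multipartite⇒copy G H (n≤1+n v) multipartite (subst (λ k → Colorable k G) (≡.sym ∣Ps∣) colouring)
  where
  a = suc (r * suc q)
  b = suc r * suc q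
  -- Part size `suc v` has room for `v` vertices and is nonzero.
  M = threshold (suc r) q (suc v)
  -- Large enough that m(m-2a-1) is at least `b * (M * M)`, which is the inequality `surplus`
  -- rearranged.
  m = suc (suc (2 * a + b * (M * M)))

  surplus : a * (m * suc m) + b * (M * M) ≤ suc a * (m * pred m)
  surplus = ≤-trans (m≤m+n _ _) (≤-reflexive (identity a (b * (M * M))))
    where
    identity : ∀ a y → a * (suc (suc (2 * a + y)) * suc (suc (suc (2 * a + y)))) + y
                       + (suc (suc (2 * a + y)) + suc (2 * a + y) * y)
                     ≡ suc a * (suc (suc (2 * a + y)) * suc (2 * a + y))
    identity = solve-∀

  few : ∀ (H : Graph m) ys u → a * length ys ≤ b * deg H u ys → b * nondeg H u ys ≤ q * length ys
  few H ys u a≤ = +-cancelˡ-≤ (a * length ys) _ _ (begin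
    a * length ys + b * nondeg H u ys             ≤⟨ +-monoˡ-≤ _ a≤ ⟩
    b * deg H u ys + b * nondeg H u ys            ≡⟨ *-distribˡ-+ b (deg H u ys) (nondeg H u ys) ⟨
    b * (deg H u ys + nondeg H u ys)              ≡⟨ cong (b *_) (deg+nondeg H u ys) ⟩
    b * length ys                                 ≡⟨ split r q (length ys) ⟩
    a * length ys + q * length ys                 ∎)
    where
    open ≤-Reasoning
    split : ∀ r q l → suc r * suc q * l ≡ suc (r * suc q) * l + q * l
    split = solve-∀

-- Exclusive copies

pushforward : ∀ {v m n} {G : Graph v} {H : Graph n} (ι : Fin m → Fin n) →
              (∀ {i j} → ι i ≡ ι j → i ≡ j) → Copy G (pullback H ι) → Copy G H
pushforward ι ι-injective c = record { φ = ι ∘ φ c ; inj = inj c ∘ ι-injective ; pres = pres c }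

module _ {n} (H : Graph n) (f : F0 H) where

  IsEdge : Fin n → Fin n → Set
  IsEdge x y = (toℕ x < toℕ y) × (adj H x y ≡ true)

  edge? : ∀ x y → Dec (IsEdge x y)
  edge? x y = (toℕ x <? toℕ y) ×-dec (adj H x y Bool.≟ true)

  -- Indicates the vertices of f(xy). Only the increasing order of the ends counts, as `Edge` lists
  -- each edge once.
  hits-edge : ∀ {x y} → Dec (IsEdge x y) → Fin n → ℕ
  hits-edge (yes p) z = equal (src H (proj₁ f (_ , p))) z + equal (tgt H (proj₁ f (_ , p))) z
  hits-edge (no _)  z = 0

  hits : Fin n → Fin n → Fin n → ℕ
  hits x y = hits-edge (edge? x y)

  hits-sparse : ∀ x y → ∑ (allFin n) (hits x y) ≤ 2
  hits-sparse x y with edge? x y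
  ... | yes p = ≤-reflexive (trans (∑-distrib-+ (equal (src H (proj₁ f (_ , p)))) _ (allFin n))
                                   (cong₂ _+_ (∑-equal (src H (proj₁ f (_ , p)))) (∑-equal (tgt H (proj₁ f (_ , p))))))
  ... | no _  = ≤-trans (≤-reflexive (trans (∑-allFin-const n 0) (*-zeroʳ n))) z≤n

  hits-ends : ∀ (e : Edge H) {z} → Ends H (proj₁ f e) z → hits (src H e) (tgt H e) z ≢ 0
  hits-ends ((x , y) , p) end with edge? x y
  ... | no ¬p = contradiction p ¬p
  -- The map `f` receives the proof component of an edge as well, so the stored proof is identified
  -- with the decided one before the values of `f` are compared.
  ... | yes p′ with ×-irrelevant p p′
    where
    ×-irrelevant : ∀ (p p′ : IsEdge x y) → p ≡ p′
    ×-irrelevant (l , t) (l′ , t′) = cong₂ _,_ (<-irrelevant l l′) (Decidable⇒UIP.≡-irrelevant Bool._≟_ t t′)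
  hits-ends ((x , y) , p) (inj₁ refl) | yes .p | refl =
    λ h → contradiction (trans (≡.sym (equal-refl (src H (proj₁ f (_ , p))))) (m+n≡0⇒m≡0 _ h)) λ ()
  hits-ends ((x , y) , p) (inj₂ refl) | yes .p | refl =
    λ h → contradiction (trans (≡.sym (equal-refl (tgt H (proj₁ f (_ , p)))))
                               (m+n≡0⇒n≡0 (equal (src H (proj₁ f (_ , p))) _) h)) λ ()

  -- For an edge `e` inside the image of `ι`, the defining property of `F0` keeps f(e) off the ends
  -- of `e`, and the hypothesis keeps it off all other sampled vertices. So f(e) misses the whole
  -- image, in particular the copy.
  unhit⇒exclusive : ∀ {m v} {G : Graph v} (ι : Fin m → Fin n) (ι-injective : ∀ {i j} → ι i ≡ ι j → i ≡ j) →
    (∀ i j l → i ≢ j → i ≢ l → j ≢ l → hits (ι i) (ι j) (ι l) ≡ 0) →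
    (c : Copy G (pullback H ι)) → Exclusive f (pushforward {H = H} ι ι-injective c)
  unhit⇒exclusive ι ι-injective unhit c = exclusive
    where
    unhit-edge : ∀ (e : Edge H) i j l → src H e ≡ ι i → tgt H e ≡ ι j → ¬ Ends H (proj₁ f e) (ι l)
    unhit-edge e@((_ , _) , x<y , _) i j l refl refl end = hits-ends e end (unhit i j l
      (λ { refl → <-irrefl refl x<y })
      (λ { refl → proj₂ f e (ι l) end (inj₁ refl) })
      (λ { refl → proj₂ f e (ι l) end (inj₂ refl) }))

    exclusive : Exclusive f (pushforward {H = H} ι ι-injective c)
    exclusive eG eH (inj₁ (s , t)) x = unhit-edge eH _ _ (φ c x) s t
    exclusive eG eH (inj₂ (s , t)) x = unhit-edge eH _ _ (φ c x) s t

-- A denser `H` would have a sampled pullback of the same density that no f(e) hits; `erdős-stone`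
-- finds `G` in it, and that copy is exclusive.
exclusive-erdős-stone : ∀ r q {v} (G : Graph v) → Colorable (suc (suc r)) G →
  ∃ λ N → ∀ n → N ≤ n → ∀ (H : Graph n) (f : F0 H) → (∀ (c : Copy G H) → ¬ Exclusive f c) →
    suc r * suc q * degreeSum H ≤ suc (suc (r * suc q)) * (n * n)
exclusive-erdős-stone r q {v} G colouring = transfer (erdős-stone r q v)
  where
  a = suc (suc (r * suc q))
  b = suc r * suc q
  transfer : (∃ λ m → ∀ (H : Graph m) → a * (m * pred m) ≤ b * degreeSum H →
                ∀ (G : Graph v) → Colorable (suc (suc r)) G → Copy G H) →
             ∃ λ N → ∀ n → N ≤ n → ∀ (H : Graph n) (f : F0 H) →
               (∀ (c : Copy G H) → ¬ Exclusive f c) → b * degreeSum H ≤ a * (n * n)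
  -- The outer `suc` provides the strict inequality that `sample` asks for, and the constant 2
  -- counts the ends of f(e).
  transfer (m , copy-in-dense) = suc (suc (b * (m * m)) * (m * m + m * (m * (m * 2)))) ,
    λ n large H f none → ≮⇒≥ λ dense →
      refute n H f none (sample n (hits H f) 2 (hits-sparse H f) m a b H large (<⇒≤ dense))
    where
    refute : ∀ n (H : Graph n) (f : F0 H) → (∀ (c : Copy G H) → ¬ Exclusive f c) →
      ¬ ∃ λ (ι : Fin m → Fin n) →
          (∀ {i j} → ι i ≡ ι j → i ≡ j) ×
          (∀ i j l → i ≢ j → i ≢ l → j ≢ l → hits H f (ι i) (ι j) (ι l) ≡ 0) ×
          a * (m * pred m) ≤ b * degreeSum (pullback H ι)
    refute n H f none (ι , ι-injective , unhit , dense) = none (pushforward {H = H} ι ι-injective c)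
      (unhit⇒exclusive H f ι ι-injective unhit c)
      where c = copy-in-dense (pullback H ι) dense G colouring

-- Lower bounds

edge-between : ∀ {n} (H : Graph n) i j → adj H i j ≡ true →
               Σ (Edge H) λ e → ∀ x → Ends H e x → x ≡ i ⊎ x ≡ j
edge-between H i j i~j with <-cmp (toℕ i) (toℕ j)
... | tri< i<j _ _ = ((i , j) , i<j , i~j) , λ _ end → end
... | tri> _ _ j<i = ((j , i) , j<i , trans (sym H j i) i~j) , λ { _ (inj₁ p) → inj₂ p ; _ (inj₂ p) → inj₁ p }
... | tri≈ _ i≡j _ with Fin.toℕ-injective i≡j
...   | refl = contradiction (trans (≡.sym (irrefl H i)) i~j) λ ()

-- At most 4n ordered adjacent pairs meet a given edge.
dense⇒F0 : ∀ {n} (H : Graph n) → 4 * n < degreeSum H → F0 H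
dense⇒F0 {n} H dense = (λ e → proj₁ (disjoint e)) , (λ e → proj₂ (disjoint e))
  where
  module _ (e : Edge H) where
    onEdge : Fin n → ℕ
    onEdge i = equal (src H e) i + equal (tgt H e) i

    ∑-onEdge : ∑ (allFin n) onEdge ≡ 2
    ∑-onEdge = trans (∑-distrib-+ (equal (src H e)) (equal (tgt H e)) (allFin n))
                     (cong₂ _+_ (∑-equal (src H e)) (∑-equal (tgt H e)))

    meeting : ∑ (allFin n) (λ i → ∑ (allFin n) λ j → onEdge i + onEdge j) ≡ 4 * n
    meeting = begin
      ∑ (allFin n) (λ i → ∑ (allFin n) λ j → onEdge i + onEdge j)
        ≡⟨ ∑-cong (allFin n) (λ i → trans (∑-distrib-+ (λ _ → onEdge i) onEdge (allFin n))
             (cong₂ _+_ (∑-allFin-const n (onEdge i)) ∑-onEdge)) ⟩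
      ∑ (allFin n) (λ i → n * onEdge i + 2)
        ≡⟨ ∑-distrib-+ (λ i → n * onEdge i) (λ _ → 2) (allFin n) ⟩
      ∑ (allFin n) (λ i → n * onEdge i) + ∑ (allFin n) (λ _ → 2)
        ≡⟨ cong₂ _+_ (trans (∑-distrib-* n onEdge (allFin n)) (cong (n *_) ∑-onEdge)) (∑-allFin-const n 2) ⟩
      n * 2 + n * 2
        ≡⟨ collect n ⟩
      4 * n ∎
      where
      open ≡-Reasoning
      collect : ∀ n → n * 2 + n * 2 ≡ 4 * n
      collect = solve-∀

    offEdge : ∀ {i} → onEdge i ≡ 0 → ¬ Ends H e i
    offEdge h (inj₁ refl) = contradiction (trans (≡.sym (equal-refl (src H e))) (m+n≡0⇒m≡0 _ h)) λ ()
    offEdge h (inj₂ refl) = contradiction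
      (trans (≡.sym (equal-refl (tgt H e))) (m+n≡0⇒n≡0 (equal (src H e) (tgt H e)) h)) λ ()

    <𝟙 : ∀ {k} β → k < 𝟙 β → k ≡ 0 × β ≡ true
    <𝟙 true (s≤s z≤n) = refl , refl

    disjoint : Σ (Edge H) λ e′ → ∀ x → Ends H e′ x → ¬ Ends H e x
    disjoint =
      -- Comparing totals gives a pair where `onEdge i + onEdge j` is below the adjacency indicator:
      -- it is adjacent and both of its vertices are off `e`.
      let i , lt  = ∑-<⇒∃< _ _ (allFin n) (subst (_< degreeSum H) (≡.sym meeting) dense)
          j , lt′ = ∑-<⇒∃< _ _ (allFin n) lt
          off , i~j = <𝟙 (adj H i j) lt′
          e′ , ends = edge-between H i j i~j
          avoid : ∀ x → x ≡ i ⊎ x ≡ j → ¬ Ends H e x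
          avoid x = λ { (inj₁ refl) → offEdge (m+n≡0⇒m≡0 _ off)
                      ; (inj₂ refl) → offEdge (m+n≡0⇒n≡0 (onEdge i) off) }
      in  e′ , λ x end → avoid x (ends x end)

complete : ∀ r → Graph r
complete r = record
  { adj    = λ i j → not (does (i Fin.≟ j))
  ; sym    = symmetric
  ; irrefl = λ i → cong not (dec-true (i Fin.≟ i) refl)
  }
  where
  symmetric : ∀ i j → not (does (i Fin.≟ j)) ≡ not (does (j Fin.≟ i))
  symmetric i j with i Fin.≟ j
  ... | yes refl = ≡.sym (cong not (dec-true (i Fin.≟ i) refl))
  ... | no  i≢j  = ≡.sym (cong not (dec-false (j Fin.≟ i) (i≢j ∘ ≡.sym)))

pullback-complete-colorable : ∀ {n r} (ι : Fin n → Fin r) → Colorable r (pullback (complete r) ι)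
pullback-complete-colorable {r = r} ι = ι , λ a b a~b ιa≡ιb →
  contradiction (trans (≡.sym a~b) (cong not (dec-true (ι a Fin.≟ ι b) ιa≡ιb))) λ ()

copy-colorable : ∀ {v n k} {G : Graph v} {H : Graph n} → Copy G H → Colorable k H → Colorable k G
copy-colorable c (colour , proper) = colour ∘ φ c , λ a b a~b → proper (φ c a) (φ c b) (pres c a b a~b)

-- A random r-partition has the density of the Turán graph on average.
dense-partite : ∀ r n → ∃ λ (H : Graph n) → Colorable (suc r) H × r * (n * pred n) ≤ suc r * degreeSum H
dense-partite r n =
  let ι , lt = ∑ᶠ-<⇒∃< n (λ _ → r * Q) (λ ι → 1 + suc r * degreeSum (pullback (complete (suc r)) ι)) averaged
  in  pullback (complete (suc r)) ι , pullback-complete-colorable ι , s≤s⁻¹ lt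
  where
  open Sampling (allFin (suc r)) (length-allFin (suc r))
  open ≤-Reasoning
  Q = n * pred n
  P = suc r ^ n
  E : (Fin n → Fin (suc r)) → ℕ
  E ι = degreeSum (pullback (complete (suc r)) ι)

  regroup : ∀ r P Q → suc r * (P * (r * Q)) ≡ P * (suc r * r) * Q
  regroup = solve-∀
  unit : ∀ r Z → suc r * (suc r * 1) * Z ≡ suc r * (suc r * Z)
  unit = solve-∀

  -- Of the ordered pairs of classes, `suc r * r` are adjacent in the complete graph.
  mean : P * (r * Q) ≡ suc r * ∑ᶠ n E
  mean = *-cancelˡ-≡ _ _ (suc r) (trans (regroup r P Q)
    (trans (cong (λ s → P * s * Q) (≡.sym (∑-∑-distinct (suc r))))
    (trans (≡.sym (∑ᶠ-degreeSum (suc r) n (complete (suc r)))) (unit r (∑ᶠ n E)))))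

  averaged : ∑ᶠ n (λ _ → r * Q) < ∑ᶠ n (λ ι → 1 + suc r * E ι)
  averaged = begin-strict
    ∑ᶠ n (λ _ → r * Q)                        ≡⟨ ∑ᶠ-const n (r * Q) ⟩
    P * (r * Q)                               ≡⟨ mean ⟩
    suc r * ∑ᶠ n E                            <⟨ m<n+m _ (m^n>0 (suc r) n) ⟩
    P + suc r * ∑ᶠ n E                        ≡⟨ cong₂ _+_ (trans (∑ᶠ-const n 1) (*-identityʳ P))
                                                        (∑ᶠ-distrib-* n (suc r) E) ⟨
    ∑ᶠ n (λ _ → 1) + ∑ᶠ n (λ ι → suc r * E ι) ≡⟨ ∑ᶠ-distrib-+ n (λ _ → 1) (λ ι → suc r * E ι) ⟨
    ∑ᶠ n (λ ι → 1 + suc r * E ι)              ∎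

-- The chromatic number.

-- Colourings are coded by the elements of a finite set, so exhaustive search decides.
colorable? : ∀ k {v} (G : Graph v) → Dec (Colorable k G)
colorable? k {v} G = map′
  (λ (code , proper) → Fin.finToFun code , proper)
  (λ (colour , proper) → Fin.funToFin colour , λ a b a~b eq → proper a b a~b
    (trans (≡.sym (Fin.finToFun-funToFin colour a)) (trans eq (Fin.finToFun-funToFin colour b))))
  (Fin.any? λ code → Fin.all? λ a → Fin.all? λ b →
    (adj G a b Bool.≟ true) →-dec ¬? (Fin.finToFun {k} {v} code a Fin.≟ Fin.finToFun code b))

-- The chromatic number is `3 + d`. The search descends from the colouring with `2 + v` colours
-- available in which all vertices differ.
critical-colours : ∀ {v} (G : Graph v) → ¬ Colorable 2 G →
                   ∃ λ d → ¬ Colorable (2 + d) G × Colorable (3 + d) G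
critical-colours {v} G ¬2 = search v ((λ a → suc (suc a)) , λ a b a~b eq →
  self-adjacent a b (Fin.suc-injective (Fin.suc-injective eq)) a~b)
  where
  self-adjacent : ∀ a b → a ≡ b → ¬ adj G a b ≡ true
  self-adjacent a .a refl a~a = contradiction (trans (≡.sym (irrefl G a)) a~a) λ ()

  search : ∀ d → Colorable (2 + d) G → ∃ λ d → ¬ Colorable (2 + d) G × Colorable (3 + d) G
  search zero    colouring = contradiction colouring ¬2
  search (suc d) colouring with colorable? (2 + d) G
  ... | yes colouring′ = search d colouring′
  ... | no  ¬colorable = d , ¬colorable , colouring

-- Comparison of the bounds and conclusion.

private
  -- The factor `4 * suc k` keeps the relative excess of the upper bound over the Turán density at
  -- most 1/(2(k+1)), and n ≥ 2k+1 controls the loss from `n` to `pred n`. Together they fit within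
  -- the ratio of `suc k` to `k`; the remainder is an explicit polynomial in `k`, `d` and `x`.
  upper-arithmetic : ∀ k d n s e → suc (2 * k) ≤ n →
    (2 + d) * (4 * suc k) * (2 * s) ≤ suc (suc (suc d * (4 * suc k))) * (n * n) →
    suc d * (n * pred n) ≤ (2 + d) * (2 * e) →
    k * s ≤ suc k * e
  upper-arithmetic k d n s e large upper lower with m≤n⇒∃[o]m+o≡n large
  ... | x , refl = *-cancelˡ-≤ (2 * ((2 + d) * (4 * suc k))) (begin
    2 * (R * K) * (k * s)                   ≡⟨ pull k (R * K) s ⟩
    k * (R * K * (2 * s))                   ≤⟨ *-monoʳ-≤ k upper ⟩
    k * (suc (suc (suc d * K)) * (n * n))   ≤⟨ m≤m+n _ _ ⟩
    k * (suc (suc (suc d * K)) * (n * n)) + n * (4 * suc k * d * (k + x) + 2 * k * x + 2 * k + 4 * x)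
                                            ≡⟨ slack k d x ⟩
    suc k * K * (suc d * (n * pred n))      ≤⟨ *-monoʳ-≤ (suc k * K) lower ⟩
    suc k * K * (R * (2 * e))               ≡⟨ push k K R e ⟩
    2 * (R * K) * (suc k * e)               ∎)
    where
    open ≤-Reasoning
    R = 2 + d
    K = 4 * suc k
    pull : ∀ k b s → 2 * b * (k * s) ≡ k * (b * (2 * s))
    pull = solve-∀
    push : ∀ k K R e → suc k * K * (R * (2 * e)) ≡ 2 * (R * K) * (suc k * e)
    push = solve-∀
    slack : ∀ k d x →
      k * (suc (suc (suc d * (4 * suc k))) * (suc (2 * k + x) * suc (2 * k + x)))
        + suc (2 * k + x) * (4 * suc k * d * (k + x) + 2 * k * x + 2 * k + 4 * x)
      ≡ suc k * (4 * suc k) * (suc d * (suc (2 * k + x) * (2 * k + x)))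
    slack = solve-∀

  -- The worst case is `d` = 0, where E ≥ n(n-1)/2 ≥ 9n/2 > 4n. The conclusion is what `dense⇒F0`
  -- asks for.
  many-edges : ∀ d n E → 10 ≤ n → suc d * (n * pred n) ≤ (2 + d) * E → 4 * n < E
  many-edges d n E large lower with m≤n⇒∃[o]m+o≡n large
  ... | y , refl = *-cancelˡ-< (2 + d) _ _ (begin-strict
    (2 + d) * (4 * (10 + y))                                  <⟨ m<m+n _ z<s ⟩
    (2 + d) * (4 * (10 + y)) + suc (9 + y) * suc (5 * d + suc d * y)
                                                              ≡⟨ slack d y ⟩
    suc d * ((10 + y) * (9 + y))                              ≤⟨ lower ⟩
    (2 + d) * E                                               ∎)
    where
    open ≤-Reasoning
    slack : ∀ d y → (2 + d) * (4 * (10 + y)) + suc (9 + y) * suc (5 * d + suc d * y)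
                    ≡ suc d * ((10 + y) * (9 + y))
    slack = solve-∀

theorem4p1 : ∀ {v} (G : Graph v) →
    (ChromaticAtLeast3 G →
    ∀ (k : ℕ) → Σ ℕ λ N → ∀ n → N ≤ n → ∀ s e → IsS n G s → IsEx n G e →
    (k * s ≤ suc k * e) × (k * e ≤ suc k * s))
    × (Bipartite G →
    ∀ (k : ℕ) → Σ ℕ λ N → ∀ n → N ≤ n → ∀ s → IsS n G s → k * s ≤ n ^ 2)
theorem4p1 {v} G = nonbipartite , bipartite
  where
  bipartite : Bipartite G → ∀ k → Σ ℕ λ N → ∀ n → N ≤ n → ∀ s → IsS n G s → k * s ≤ n ^ 2
  -- With `r` = 0 and `q` = `k` the bound on the degree sum is 2/(k+1) times the square of `n`.
  bipartite colouring k = Product.map₂ (λ bound → λ { n large s ((H , refl , f , none) , _) →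
        *-cancelˡ-≤ 2 (begin
          2 * (k * edgeCount H)               ≡⟨ swap k (edgeCount H) ⟩
          k * (2 * edgeCount H)               ≤⟨ *-monoˡ-≤ (2 * edgeCount H) (≤-trans (n≤1+n k)
                                                   (≤-reflexive (≡.sym (*-identityˡ (suc k))))) ⟩
          1 * suc k * (2 * edgeCount H)       ≡⟨ cong (1 * suc k *_) (degreeSum≡2*edgeCount H) ⟨
          1 * suc k * degreeSum H             ≤⟨ bound n large H f none ⟩
          2 * (n * n)                         ≡⟨ cong (λ m → 2 * (n * m)) (*-identityʳ n) ⟨
          2 * n ^ 2                           ∎) }) (exclusive-erdős-stone 0 k G colouring)
    where
    open ≤-Reasoning
    swap : ∀ k e → 2 * (k * e) ≡ k * (2 * e)
    swap = solve-∀

  nonbipartite : ChromaticAtLeast3 G → ∀ k → Σ ℕ λ N → ∀ n → N ≤ n → ∀ s e → IsS n G s → IsEx n G e →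
    (k * s ≤ suc k * e) × (k * e ≤ suc k * s)
  nonbipartite ¬2 k =
    let d , ¬colorable , colouring = critical-colours G ¬2
    in  Product.map (_+ (suc (2 * k) + 10)) (comparison d ¬colorable)
          -- The choice of `q` makes `suc q` equal to `4 * suc k`, the accuracy used in
          -- `upper-arithmetic`.
          (exclusive-erdős-stone (suc d) (pred (4 * suc k)) G colouring)
    where
    comparison : ∀ d → ¬ Colorable (2 + d) G → ∀ {N} →
      (∀ n → N ≤ n → ∀ (H : Graph n) (f : F0 H) → (∀ (c : Copy G H) → ¬ Exclusive f c) →
        (2 + d) * (4 * suc k) * degreeSum H ≤ suc (suc (suc d * (4 * suc k))) * (n * n)) →
      ∀ n → N + (suc (2 * k) + 10) ≤ n → ∀ s e → IsS n G s → IsEx n G e →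
      (k * s ≤ suc k * e) × (k * e ≤ suc k * s)
    comparison d ¬colorable {N} bound n large s e ((H , refl , f , none) , s-max) ((H′ , refl , G-free) , e-max) =
        upper-arithmetic k d n _ _ (m+n≤o⇒m≤o _ large′) upper lower
      -- The extremal `G`-free graph is dense enough to carry some `f` and has no copy of `G` at
      -- all, so its edge count is at most `s`.
      , *-mono-≤ (n≤1+n k) (s-max (edgeCount H′)
          (H′ , refl , dense⇒F0 H′ (many-edges d n _ (m+n≤o⇒n≤o (suc (2 * k)) large′)
                  (subst (λ E → suc d * (n * pred n) ≤ (2 + d) * E) (≡.sym (degreeSum≡2*edgeCount H′)) lower))
              , λ c _ → G-free c))
      where
      large′ : suc (2 * k) + 10 ≤ n
      large′ = m+n≤o⇒n≤o N large

      upper : (2 + d) * (4 * suc k) * (2 * edgeCount H) ≤ suc (suc (suc d * (4 * suc k))) * (n * n)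
      upper = subst (λ E → (2 + d) * (4 * suc k) * E ≤ suc (suc (suc d * (4 * suc k))) * (n * n))
        (degreeSum≡2*edgeCount H) (bound n (m+n≤o⇒m≤o N large) H f none)

      lower : suc d * (n * pred n) ≤ (2 + d) * (2 * edgeCount H′)
      -- A graph with a proper colouring in `2 + d` colours contains no copy of `G`, so the extremal
      -- graph has at least as many edges as `T`.
      lower = let T , T-colorable , T-dense = dense-partite (suc d) n in
        ≤-trans T-dense (*-monoʳ-≤ (2 + d) (≤-trans (≤-reflexive (degreeSum≡2*edgeCount T))
          (*-monoʳ-≤ 2 (e-max (edgeCount T) (T , refl , λ c → ¬colorable (copy-colorable c T-colorable))))))
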